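{- Let $G$ be a finite abelian group with $n$ elements, and let $S\subseteq G$ be a generating set of $G$ with $0_G\notin S$. Then the cop number of the directed Cayley graph $\mathrm{Cay}(G,S)$ satisfies $$c(\mathrm{Cay}(G,S))\le \sqrt{\frac{2}{(\sqrt{2}-1)\,e}}\;\sqrt{n}+2.$$
   Context: Cops and robbers on a finite strongly connected digraph: first each cop chooses a starting vertex, then the robber chooses a starting vertex. Then cop turns and robber turns alternate, starting with a cop turn. On a cop turn each cop either stays where it is or moves along an arc, in the direction of the arc, to an out-neighbour; on a robber turn the robber does likewise. Several cops may share a vertex, and all players have full information. The cops win if at some point a cop shares a vertex with the robber; the robber wins if this never happens. The cop number $c(\Gamma)$ is the minimum number of cops for which the cops have a winning strategy on $\Gamma$. For a finite abelian group $(G,+)$ and a generating set $S$ with $0_G\notin S$, $\mathrm{Cay}(G,S)$ is the digraph with vertex set $G$ containing the arc from $u$ to $v$ iff $v-u\in S$. Here $e$ is the base of the natural logarithm. -}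

module Defs where

open import Level using (Level; _⊔_) renaming (suc to lsuc)
open import Algebra.Bundles using (AbelianGroup)
open import Data.Fin using (Fin)
open import Data.Integer using (+_)
open import Data.List using (List; []; _∷_)
open import Data.Nat as ℕ using (ℕ; zero; suc; _!)
open import Data.Nat.Induction using (<-rec)
open import Data.Nat.Properties as ℕₚ using (_!≢0)
open import Data.Product using (_×_; _,_; ∃; ∃-syntax)
open import Data.Rational as ℚ using (ℚ; 0ℚ; 1ℚ)
open import Data.Sum using (_⊎_; inj₁)
open import Function.Bundles using (Inverse)
open import Relation.Binary using (Setoid; Rel; _Respects_; _Respects₂_)
open import Relation.Binary.PropositionalEquality as ≡ using (_≡_)
open import Relation.Nullary using (¬_)
open import Relation.Unary using (Pred)

private
  variable
    a ℓ p : Level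

HasSize : Setoid a ℓ → ℕ → Set (a ⊔ ℓ)
HasSize A n = Inverse A (≡.setoid (Fin n))

------------------------------------------------------------------------
-- Cops and robbers

record Digraph a ℓ p : Set (lsuc (a ⊔ ℓ ⊔ p)) where
  field
    vertices : Setoid a ℓ
  open Setoid vertices public using (_≈_) renaming (Carrier to Vertex)
  field
    Arc      : Rel Vertex p
    Arc-resp : Arc Respects₂ _≈_

module Game (Γ : Digraph a ℓ p) where
  open Digraph Γ

  Step : Rel Vertex (ℓ ⊔ p)
  Step u v = u ≈ v ⊎ Arc u v

  -- A strategy for k cops against a fully visible robber.  Its argument is
  -- the list of robber positions so far, most recent first: `position []`
  -- is the initial placement, and `position (rₜ ∷ … ∷ r₀ ∷ [])` is where the
  -- cops stand after the cop turn that answers rₜ.  The cops' own past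
  -- positions are determined by the strategy, so they need not be an argument.
  record Strategy (k : ℕ) : Set (a ⊔ ℓ ⊔ p) where
    field
      position : List Vertex → Fin k → Vertex
      legal    : ∀ h r i → Step (position h i) (position (r ∷ h) i)

  -- The robber starts at `r 0` and stands at `r t` after t of its turns.
  RobberPlay : (ℕ → Vertex) → Set (ℓ ⊔ p)
  RobberPlay r = ∀ t → Step (r t) (r (suc t))

  before : (ℕ → Vertex) → ℕ → List Vertex
  before r zero    = []
  before r (suc t) = r t ∷ before r t

  -- With the robber at `r t`, the cops stand first at `position (before r t)`
  -- and then, after their turn, at `position (before r (suc t))`.
  Captures : ∀ {k} → Strategy k → (ℕ → Vertex) → Set ℓ
  Captures σ r = ∃[ t ] ∃[ i ]
      (position (before r t) i ≈ r t ⊎ position (before r (suc t)) i ≈ r t)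
    where open Strategy σ

  CopsWin : ℕ → Set (a ⊔ ℓ ⊔ p)
  CopsWin k = ∃[ σ ] (∀ r → RobberPlay r → Captures {k} σ r)

  IsCopNumber : ℕ → Set (a ⊔ ℓ ⊔ p)
  IsCopNumber c = CopsWin c × (∀ k → CopsWin k → c ℕ.≤ k)

  IsCopNumber-unique : ∀ {c d} → IsCopNumber c → IsCopNumber d → c ≡ d
  IsCopNumber-unique (wc , minc) (wd , mind) =
    ℕₚ.≤-antisym (minc _ wd) (mind _ wc)

  allVerticesWin : ∀ {n} → HasSize vertices n → CopsWin n
  allVerticesWin V≅n =
    record { position = λ _ → from ; legal = λ _ _ _ → inj₁ (Setoid.refl vertices) } ,
    λ r _ → 0 , to (r 0) , inj₁ (strictlyInverseʳ (r 0))
    where open Inverse V≅n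

  -- Double negation, since no decision procedure for `CopsWin` is given.
  IsCopNumber-exists : ∀ {n} → HasSize vertices n → ¬ ¬ ∃ IsCopNumber
  IsCopNumber-exists V≅n none =
    <-rec (λ k → ¬ CopsWin k)
      (λ k ih win → none (k , win , λ j winⱼ → ℕₚ.≮⇒≥ (λ j<k → ih j<k winⱼ)))
      _ (allVerticesWin V≅n)

open Game public using (CopsWin; IsCopNumber)

------------------------------------------------------------------------
-- Cayley digraphs

module _ (G : AbelianGroup a ℓ) where
  open AbelianGroup G

  data Span (S : Pred Carrier p) : Pred Carrier (a ⊔ ℓ ⊔ p) where
    gen  : ∀ {x} → S x → Span S x
    unit : Span S ε
    mul  : ∀ {x y} → Span S x → Span S y → Span S (x ∙ y)
    inv  : ∀ {x} → Span S x → Span S (x ⁻¹)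
    resp : ∀ {x y} → x ≈ y → Span S x → Span S y

  Generates : Pred Carrier p → Set (a ⊔ ℓ ⊔ p)
  Generates S = ∀ x → Span S x

  Cay : (S : Pred Carrier p) → S Respects _≈_ → Digraph a ℓ p
  Cay S S-resp = record
    { vertices = setoid
    ; Arc      = λ u v → S (v - u)
    ; Arc-resp = (λ v≈w → S-resp (∙-congʳ v≈w))
               , (λ u≈w → S-resp (∙-congˡ (⁻¹-cong u≈w)))
    }

------------------------------------------------------------------------
-- Real numbers as Dedekind cuts: `Lower x q` is q < x and `Upper x q` is
-- x < q.  The cut axioms are not bundled.

record ℝ : Set₁ where
  field
    Lower : Pred ℚ Level.zero
    Upper : Pred ℚ Level.zero
open ℝ public

infix  4 _<ᵣ_ _≤ᵣ_
infixl 6 _+ᵣ_ _-ᵣ_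
infixl 7 _*ᵣ_ _/ᵣ_
infix  8 -ᵣ_ √_

_<ᵣ_ : ℝ → ℝ → Set
x <ᵣ y = ∃[ q ] Upper x q × Lower y q

_≤ᵣ_ : ℝ → ℝ → Set
x ≤ᵣ y = ¬ (y <ᵣ x)

fromℚ : ℚ → ℝ
fromℚ x = record { Lower = λ q → q ℚ.< x ; Upper = λ q → x ℚ.< q }

fromℕ : ℕ → ℝ
fromℕ n = fromℚ (+ n ℚ./ 1)

_+ᵣ_ : ℝ → ℝ → ℝ
x +ᵣ y = record
  { Lower = λ q → ∃[ s ] ∃[ t ] Lower x s × Lower y t × q ℚ.< s ℚ.+ t
  ; Upper = λ q → ∃[ s ] ∃[ t ] Upper x s × Upper y t × s ℚ.+ t ℚ.< q
  }

-ᵣ_ : ℝ → ℝ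
-ᵣ x = record { Lower = λ q → Upper x (ℚ.- q) ; Upper = λ q → Lower x (ℚ.- q) }

_-ᵣ_ : ℝ → ℝ → ℝ
x -ᵣ y = x +ᵣ (-ᵣ y)

-- Interval arithmetic: for x in (s , s′) and y in (t , t′) the product lies
-- between the least and the greatest of the four products of endpoints.
_*ᵣ_ : ℝ → ℝ → ℝ
x *ᵣ y = record
  { Lower = λ q → ∃[ s ] ∃[ s′ ] ∃[ t ] ∃[ t′ ]
      Lower x s × Upper x s′ × Lower y t × Upper y t′ ×
      q ℚ.< ((s ℚ.* t) ℚ.⊓ (s ℚ.* t′)) ℚ.⊓ ((s′ ℚ.* t) ℚ.⊓ (s′ ℚ.* t′))
  ; Upper = λ q → ∃[ s ] ∃[ s′ ] ∃[ t ] ∃[ t′ ]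
      Lower x s × Upper x s′ × Lower y t × Upper y t′ ×
      ((s ℚ.* t) ℚ.⊔ (s ℚ.* t′)) ℚ.⊔ ((s′ ℚ.* t) ℚ.⊔ (s′ ℚ.* t′)) ℚ.< q
  }

-- The reciprocal of a positive real; meaningless otherwise.
recip⁺ : ℝ → ℝ
recip⁺ x = record
  { Lower = λ q → ∃[ r ] 0ℚ ℚ.< r × Upper x r × q ℚ.* r ℚ.< 1ℚ
  ; Upper = λ q → ∃[ r ] 0ℚ ℚ.< r × Lower x r × 1ℚ ℚ.< q ℚ.* r
  }

_/ᵣ_ : ℝ → ℝ → ℝ
x /ᵣ y = x *ᵣ recip⁺ y

-- The square root of a nonnegative real; meaningless otherwise.
√_ : ℝ → ℝ
√ x = record
  { Lower = λ q → q ℚ.< 0ℚ ⊎ Lower x (q ℚ.* q)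
  ; Upper = λ q → 0ℚ ℚ.< q × Upper x (q ℚ.* q)
  }

∑1/_! : ℕ → ℚ
∑1/ zero  ! = 1ℚ
∑1/ suc k ! = ∑1/ k ! ℚ.+ (+ 1 ℚ./ (suc k !)) {{suc k !≢0}}

-- The supremum of the partial sums of ∑ 1/i!.
e : ℝ
e = record
  { Lower = λ q → ∃[ k ] q ℚ.< ∑1/ k !
  ; Upper = λ q → ∃[ r ] r ℚ.< q × (∀ k → ∑1/ k ! ℚ.≤ r)
  }

{-# OPTIONS --safe #-}

-- Let T = S ∪ {0} and let dᵢ be the difference between the robber and cop i.
-- When the robber moves by s and cop i by t ∈ T, dᵢ changes by s - t.  Fix a.
-- Once dᵢ ∈ ⟨a⟩, cop i "guards" every s with s - a ∈ T: it answers such an s by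
-- s - a, which adds a to dᵢ, and any other move by copying it, so the robber can
-- use guarded moves only finitely often.  To bring some dᵢ into ⟨a⟩ the cops play
-- the game in the quotient by ⟨a⟩.  Hence c(G, U) ≤ max (c(G/⟨a⟩, U), 1 + c(G, U ∖ A)),
-- where c(G, U) is the number of cops needed if the robber moves only by U ⊆ T,
-- and A is the set of moves guarded with a.
--
-- By averaging there is an a ≠ 0 which guards a fraction 1/(f+1) of U, where
-- f ≥ n/|T|, as long as |U| > f; this persists in all quotients.  So j guards
-- leave |T| (f/(f+1))ʲ moves, and when at most f moves are left one cop is spent
-- on each.  Optimising over f, k cops suffice when 7 n < 4 (k - 1)², and
-- 7/4 < 2/((√2 - 1) e).

module Submission where

open import Defs
open import Algebra.Bundles using (AbelianGroup; CommutativeMonoid; RawGroup)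
open import Algebra.Core using (Op₁; Op₂)
import Algebra.Morphism.GroupMonomorphism as GroupMonomorphism
open import Algebra.Morphism.Structures using (IsGroupMonomorphism)
import Algebra.Properties.AbelianGroup as AbelianGroupProperties
import Algebra.Properties.Monoid.Mult as Mult
import Algebra.Solver.CommutativeMonoid as CommutativeMonoidSolver
open import Algebra.Structures using (IsAbelianGroup)
open import Data.Bool using (true; false; if_then_else_)
open import Data.Bool.Properties using (T?)
open import Data.Fin using (Fin; zero; suc; toℕ; fromℕ<; punchIn; punchOut; _≟_)
open import Data.Fin.Permutation using (Permutation′; permutation)
open import Data.Fin.Properties using (any?; pigeonhole; punchIn-punchOut; toℕ-fromℕ<)
import Data.Integer as ℤ
import Data.Integer.Properties as ℤ
open import Data.List using (List; []; _∷_; length; filter; tabulate; deduplicate; allFin)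
open import Data.List.Membership.Propositional.Properties using (∈-filter⁺; ∈-allFin)
open import Data.List.Properties using (length-tabulate; length-filter; length-deduplicate; filter-none)
open import Data.List.Relation.Unary.All as All using (All; []; _∷_)
import Data.List.Relation.Unary.All.Properties as All
open import Data.List.Relation.Unary.AllPairs using (AllPairs; []; _∷_)
open import Data.List.Relation.Unary.Any as Any using (Any; here; there)
import Data.List.Relation.Unary.Any.Properties as Any
open import Data.List.Relation.Unary.Unique.DecSetoid.Properties using (deduplicate-!)
open import Data.Nat as ℕ using (ℕ; zero; suc; _!)
import Data.Nat.Coprimality as Coprime
import Data.Nat.Properties as ℕ
open import Data.Nat.Tactic.RingSolver using (solve-∀)
open import Data.Product using (_×_; _,_; ∃-syntax; proj₁; proj₂)
import Data.Rational.Properties as ℚ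
import Data.Rational.Unnormalised as ℚᵘ
import Data.Rational.Unnormalised.Properties as ℚᵘ
open import Data.Sum using (_⊎_; inj₁; inj₂)
open import Data.Vec.Functional using (insertAt; removeAt)
open import Data.Vec.Functional.Properties using (insertAt-lookup; insertAt-punchIn)
open import Function using (_∘_)
open import Function.Bundles using (Inverse)
open import Level using (Level; 0ℓ)
open import Relation.Binary using (Rel; IsDecEquivalence; DecSetoid; _Respects_)
import Relation.Binary.PropositionalEquality as ≡
open import Relation.Binary.PropositionalEquality using (_≡_; refl; sym; trans; cong; cong₂; subst; subst₂; module ≡-Reasoning)
open import Relation.Nullary using (Dec; yes; no; does; ¬_; ¬?; contradiction)
open import Relation.Nullary.Decidable using (True; ¬¬-excluded-middle; isYes; _×-dec_; _⊎-dec_; map′; from-yes; toWitness; fromWitness)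
open import Relation.Unary using (Pred; Decidable; _⊆_)

private
  variable
    ℓ₁ ℓ₂ p q : Level
    A : Set ℓ₁
    B : Set ℓ₂
    n : ℕ

-- Rational estimates for the real bound

module RealBound where
  open import Algebra.Properties.CommutativeSemigroup (CommutativeMonoid.commutativeSemigroup ℚ.*-1-commutativeMonoid) using (interchange)
  open import Algebra.Properties.Group ℚ.+-0-group using (⁻¹-involutive)
  open import Data.Integer using (+_)
  open import Data.Rational
  open import Data.Rational.Properties

  ι : ℕ → ℚ
  ι n = + n / 1

  -- `_/_` normalises by a gcd and is stuck on a variable; the explicit normal form exposes
  -- numerator and denominator.
  ι≡mkℚ : ∀ n → ι n ≡ mkℚ (+ n) 0 (Coprime.sym (Coprime.1-coprimeTo n))
  ι≡mkℚ n = ↥p/↧p≡p (mkℚ (+ n) 0 (Coprime.sym (Coprime.1-coprimeTo n)))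

  ι-cancel-< : ∀ {m n} → ι m < ι n → m ℕ.< n
  ι-cancel-< {m} {n} m<n = ℤ.drop‿+<+ (subst₂ ℤ._<_ (ℤ.*-identityʳ (+ m)) (ℤ.*-identityʳ (+ n))
    (drop-*<* (subst₂ _<_ (ι≡mkℚ m) (ι≡mkℚ n) m<n)))

  ι-+ : ∀ m n → ι (m ℕ.+ n) ≡ ι m + ι n
  ι-+ m n rewrite ι≡mkℚ m | ι≡mkℚ n =
    cong (_/ 1) (sym (cong₂ ℤ._+_ (ℤ.*-identityʳ (+ m)) (ℤ.*-identityʳ (+ n))))

  ι-* : ∀ m n → ι (m ℕ.* n) ≡ ι m * ι n
  ι-* m n rewrite ι≡mkℚ m | ι≡mkℚ n = cong (_/ 1) (ℤ.pos-* m n)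

  *-mono-<-pos : ∀ {p p′ q q′} → 0ℚ < p → 0ℚ < q → p < p′ → q < q′ → p * q < p′ * q′
  *-mono-<-pos {p} {p′} {q} {q′} 0<p 0<q p<p′ q<q′ = <-trans
    (*-monoˡ-<-pos q {{positive 0<q}} p<p′) (*-monoʳ-<-pos p′ {{positive (<-trans 0<p p<p′)}} q<q′)

  0<* : ∀ {p q} → 0ℚ < p → 0ℚ < q → 0ℚ < p * q
  0<* {p} {q} 0<p 0<q = subst (_< p * q) (*-zeroˡ q) (*-monoˡ-<-pos q {{positive 0<q}} 0<p)

  -- Since 3/2 = 1 + ½, a term at most a third of its predecessor, together with half of itself,
  -- fits into half of the predecessor.
  3/n≤1/m : ∀ m n .{{_ : ℕ.NonZero m}} .{{_ : ℕ.NonZero n}} → 3 ℕ.* m ℕ.≤ n →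
              (+ 1 / n) * (+ 3 / 2) ≤ (+ 1 / m) * ½
  3/n≤1/m (suc m) (suc n) 3m≤n = toℚᵘ-cancel-≤ (begin
    toℚᵘ ((+ 1 / suc n) * (+ 3 / 2))     ≃⟨ toℚᵘ-homo-* (+ 1 / suc n) (+ 3 / 2) ⟩
    toℚᵘ (+ 1 / suc n) ℚᵘ.* toℚᵘ (+ 3 / 2) ≃⟨ ℚᵘ.*-congʳ (toℚᵘ-fromℚᵘ (ℚᵘ.mkℚᵘ (+ 1) n)) ⟩
    ℚᵘ.mkℚᵘ (+ 1) n ℚᵘ.* toℚᵘ (+ 3 / 2)  ≤⟨ ℚᵘ.*≤* (ℤ.+≤+ bound) ⟩
    ℚᵘ.mkℚᵘ (+ 1) m ℚᵘ.* toℚᵘ ½          ≃⟨ ℚᵘ.*-congʳ (toℚᵘ-fromℚᵘ (ℚᵘ.mkℚᵘ (+ 1) m)) ⟨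
    toℚᵘ (+ 1 / suc m) ℚᵘ.* toℚᵘ ½       ≃⟨ toℚᵘ-homo-* (+ 1 / suc m) ½ ⟨
    toℚᵘ ((+ 1 / suc m) * ½)             ∎)
    where
    open ℚᵘ.≤-Reasoning
    bound : 3 ℕ.* (suc m ℕ.* 2) ℕ.≤ 1 ℕ.* (suc n ℕ.* 2)
    bound = subst₂ ℕ._≤_ (ℕ.*-assoc 3 (suc m) 2) (sym (ℕ.*-identityˡ (suc n ℕ.* 2))) (ℕ.*-monoˡ-≤ 2 3m≤n)

  -- From 1/3! on, each term is at most a third of the previous one; so the tail
  -- after a term is at most half of that term.
  e-partial-sum : ∀ k → ∑1/ (2 ℕ.+ k) ! + (+ 1 / ((2 ℕ.+ k) !)) {{(2 ℕ.+ k) ℕ.!≢0}} * ½ ≤ + 11 / 4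
  e-partial-sum zero    = ≤-refl
  e-partial-sum (suc k) = begin
    (s + x) + x * ½       ≡⟨ +-assoc s x (x * ½) ⟩
    s + (x + x * ½)       ≡⟨ cong (λ y → s + (y + x * ½)) (*-identityʳ x) ⟨
    s + (x * 1ℚ + x * ½)  ≡⟨ cong (λ y → s + y) (*-distribˡ-+ x 1ℚ ½) ⟨
    s + x * (+ 3 / 2)     ≤⟨ +-monoʳ-≤ s (3/n≤1/m ((2 ℕ.+ k) !) ((3 ℕ.+ k) !) {{(2 ℕ.+ k) ℕ.!≢0}} {{(3 ℕ.+ k) ℕ.!≢0}}
                              (ℕ.*-monoˡ-≤ ((2 ℕ.+ k) !) (ℕ.m≤m+n 3 k))) ⟩
    s + y * ½             ≤⟨ e-partial-sum k ⟩
    + 11 / 4              ∎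
    where
    open ≤-Reasoning
    s = ∑1/ (2 ℕ.+ k) !
    x = (+ 1 / ((3 ℕ.+ k) !)) {{(3 ℕ.+ k) ℕ.!≢0}}
    y = (+ 1 / ((2 ℕ.+ k) !)) {{(2 ℕ.+ k) ℕ.!≢0}}

  ∑1/k!≤11/4 : ∀ k → ∑1/ k ! ≤ + 11 / 4
  ∑1/k!≤11/4 0 = from-yes (1ℚ ≤? + 11 / 4)
  ∑1/k!≤11/4 1 = from-yes (∑1/ 1 ! ≤? + 11 / 4)
  ∑1/k!≤11/4 (suc (suc k)) = ≤-trans (p≤p+q {{nonNeg*nonNeg⇒nonNeg y {{y≥0}} ½}}) (e-partial-sum k)
    where
    y≥0 = normalize-nonNeg 1 ((2 ℕ.+ k) !) {{(2 ℕ.+ k) ℕ.!≢0}}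
    y = (+ 1 / ((2 ℕ.+ k) !)) {{(2 ℕ.+ k) ℕ.!≢0}}
    p≤p+q : ∀ {p q} .{{_ : NonNegative q}} → p ≤ p + q
    p≤p+q {p} {q} = subst (_≤ p + q) (+-identityʳ p) (+-monoʳ-≤ p (nonNegative⁻¹ q))

  Lower-e : ∀ {q} → Lower e q → q < + 11 / 4
  Lower-e (k , q<) = <-≤-trans q< (∑1/k!≤11/4 k)

  Upper-e : ∀ {q} → Upper e q → 0ℚ < q
  Upper-e (r , r<q , sums≤r) = <-trans (from-yes (0ℚ <? 1ℚ)) (≤-<-trans (sums≤r 0) r<q)

  -- The square of 283/200 is 80089/40000, just above 2.
  Lower-√2 : ∀ {q} → Lower (√ fromℕ 2) q → q < + 283 / 200
  Lower-√2 (inj₁ q<0) = <-trans q<0 (from-yes (0ℚ <? + 283 / 200))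
  Lower-√2 {q} (inj₂ q²<2) = ≰⇒> λ 283/200≤q → <-irrefl refl (begin-strict
    + 283 / 200 * (+ 283 / 200) ≤⟨ *-monoˡ-≤-nonNeg (+ 283 / 200) 283/200≤q ⟩
    + 283 / 200 * q             ≤⟨ *-monoʳ-≤-nonNeg q {{nonNegative (≤-trans (from-yes (0ℚ ≤? + 283 / 200)) 283/200≤q)}} 283/200≤q ⟩
    q * q                       <⟨ q²<2 ⟩
    ι 2                         <⟨ from-yes (ι 2 <? + 283 / 200 * (+ 283 / 200)) ⟩
    + 283 / 200 * (+ 283 / 200) ∎)
    where open ≤-Reasoning

  Lower-√2-1 : ∀ {q} → Lower (√ fromℕ 2 -ᵣ fromℕ 1) q → q < + 83 / 200
  Lower-√2-1 {q} (u , v , u<√2 , 1<-v , q<u+v) = begin-strict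
    q                    <⟨ q<u+v ⟩
    u + v                <⟨ +-mono-< (Lower-√2 u<√2) v<-1 ⟩
    + 283 / 200 + - ι 1  ≡⟨⟩
    + 83 / 200           ∎
    where
    open ≤-Reasoning
    v<-1 : v < - ι 1
    v<-1 = subst (_< - ι 1) (⁻¹-involutive v) (neg-antimono-< 1<-v)

  -- 8/7 is 2 divided by 7/4. The estimates 83/200 for √2 - 1 and 11/4 for `e` multiply to 913/800,
  -- just below it.
  Lower-denominator : ∀ {r} → 0ℚ < r → Lower ((√ fromℕ 2 -ᵣ fromℕ 1) *ᵣ e) r → r < + 8 / 7
  Lower-denominator {r} 0<r (s , s′ , t , t′ , s< , _ , t< , <t′ , r<min) with 0ℚ <? s
  -- The corner `s * t′` of the interval product would be at most 0, although it exceeds the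
  -- positive `r`.
  ... | no s≯0 = contradiction (begin-strict
    0ℚ         <⟨ 0<r ⟩
    r          <⟨ r<min ⟩
    _          ≤⟨ ≤-trans (p⊓q≤p (s * t ⊓ (s * t′)) (s′ * t ⊓ (s′ * t′))) (p⊓q≤q (s * t) (s * t′)) ⟩
    s * t′     ≤⟨ *-monoʳ-≤-nonNeg t′ {{nonNegative (<⇒≤ (Upper-e <t′))}} (≮⇒≥ s≯0) ⟩
    0ℚ * t′    ≡⟨ *-zeroˡ t′ ⟩
    0ℚ         ∎) (<-irrefl refl)
    where open ≤-Reasoning
  ... | yes 0<s = begin-strict
    r                          <⟨ r<min ⟩
    _                          ≤⟨ ≤-trans (p⊓q≤p (s * t ⊓ (s * t′)) (s′ * t ⊓ (s′ * t′))) (p⊓q≤p (s * t) (s * t′)) ⟩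
    s * t                      ≤⟨ *-monoˡ-≤-nonNeg s {{nonNegative (<⇒≤ 0<s)}} (<⇒≤ (Lower-e t<)) ⟩
    s * (+ 11 / 4)             ≤⟨ *-monoʳ-≤-nonNeg (+ 11 / 4) (<⇒≤ (Lower-√2-1 s<)) ⟩
    (+ 83 / 200) * (+ 11 / 4)  <⟨ from-yes ((+ 83 / 200) * (+ 11 / 4) <? + 8 / 7) ⟩
    + 8 / 7                    ∎
    where open ≤-Reasoning

  Upper-quotient : ∀ {w} → Upper (fromℕ 2 /ᵣ ((√ fromℕ 2 -ᵣ fromℕ 1) *ᵣ e)) w → + 7 / 4 < w
  Upper-quotient {w} (x , x′ , y , y′ , _ , 2<x′ , _ , (r , 0<r , r<denominator , 1<y′r) , max<w) = begin-strict
    + 7 / 4             ≡⟨⟩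
    ι 2 * (+ 7 / 8)     <⟨ *-mono-<-pos (from-yes (0ℚ <? ι 2)) (from-yes (0ℚ <? + 7 / 8)) 2<x′ 7/8<y′ ⟩
    x′ * y′             ≤⟨ ≤-trans (p≤q⊔p (x′ * y) (x′ * y′)) (p≤q⊔p ((x * y) ⊔ (x * y′)) _) ⟩
    _                   <⟨ max<w ⟩
    w                   ∎
    where
    open ≤-Reasoning
    7/8<y′ : + 7 / 8 < y′
    7/8<y′ = *-cancelʳ-<-nonNeg r {{nonNegative (<⇒≤ 0<r)}} (begin-strict
      + 7 / 8 * r         <⟨ *-monoʳ-<-pos (+ 7 / 8) (Lower-denominator 0<r r<denominator) ⟩
      + 7 / 8 * (+ 8 / 7) ≡⟨⟩
      1ℚ                  <⟨ 1<y′r ⟩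
      y′ * r              ∎)

  -- All that the combinatorics needs from the real inequality. The upper endpoints satisfy x′² >
  -- 7/4, y′² > n and x′y′ + 2 < c, so 7n < 4(x′y′)² < 4k² for k = c - 2.
  bound-below : ∀ {n c} → √ (fromℕ 2 /ᵣ ((√ (fromℕ 2) -ᵣ fromℕ 1) *ᵣ e)) *ᵣ √ (fromℕ n) +ᵣ fromℕ 2 <ᵣ fromℕ c →
                ∃[ k ] c ≡ 2 ℕ.+ k × 7 ℕ.* n ℕ.< 4 ℕ.* (k ℕ.* k)
  bound-below {n} {c} (q , (s , t , (x , x′ , y , y′ , _ , (0<x′ , x′²>) , _ , (0<y′ , n<y′²) , max<s) , 2<t , s+t<q) , q<c) =
    k , sym c≡2+k , ι-cancel-< (begin-strict
      ι (7 ℕ.* n)                      ≡⟨ ι-* 7 n ⟩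
      ι 7 * ι n                        ≤⟨ *-monoˡ-≤-nonNeg (ι 7) (<⇒≤ n<y′²) ⟩
      ι 7 * (y′ * y′)                  ≡⟨⟩
      ι 4 * (+ 7 / 4) * (y′ * y′)      ≡⟨ *-assoc (ι 4) (+ 7 / 4) (y′ * y′) ⟩
      ι 4 * (+ 7 / 4 * (y′ * y′))      <⟨ *-monoʳ-<-pos (ι 4) (*-monoˡ-<-pos (y′ * y′) {{positive (0<* 0<y′ 0<y′)}} (Upper-quotient x′²>)) ⟩
      ι 4 * (x′ * x′ * (y′ * y′))      ≡⟨ cong (ι 4 *_) (interchange x′ x′ y′ y′) ⟩
      ι 4 * (x′ * y′ * (x′ * y′))      <⟨ *-monoʳ-<-pos (ι 4) (*-mono-<-pos 0<x′y′ 0<x′y′ x′y′<k x′y′<k) ⟩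
      ι 4 * (ι k * ι k)                ≡⟨ cong (ι 4 *_) (ι-* k k) ⟨
      ι 4 * ι (k ℕ.* k)                ≡⟨ ι-* 4 (k ℕ.* k) ⟨
      ι (4 ℕ.* (k ℕ.* k))              ∎)
    where
    open ≤-Reasoning
    0<x′y′ : 0ℚ < x′ * y′
    0<x′y′ = 0<* 0<x′ 0<y′
    x′y′+2<c : x′ * y′ + ι 2 < ι c
    x′y′+2<c = begin-strict
      x′ * y′ + ι 2  <⟨ +-mono-< (≤-<-trans (≤-trans (p≤q⊔p (x′ * y) (x′ * y′)) (p≤q⊔p ((x * y) ⊔ (x * y′)) _)) max<s) 2<t ⟩
      s + t          <⟨ s+t<q ⟩
      q              <⟨ q<c ⟩
      ι c            ∎
    2<c : 2 ℕ.< c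
    2<c = ι-cancel-< (begin-strict
      ι 2            ≡⟨ +-identityˡ (ι 2) ⟨
      0ℚ + ι 2       <⟨ +-monoˡ-< (ι 2) 0<x′y′ ⟩
      x′ * y′ + ι 2  <⟨ x′y′+2<c ⟩
      ι c            ∎)
    k = c ℕ.∸ 2
    c≡2+k : 2 ℕ.+ k ≡ c
    c≡2+k = ℕ.m+[n∸m]≡n (ℕ.<⇒≤ 2<c)
    x′y′<k : x′ * y′ < ι k
    x′y′<k = ≰⇒> λ k≤x′y′ → <-irrefl refl (begin-strict
      ι c            ≡⟨ cong ι (trans (ℕ.+-comm k 2) c≡2+k) ⟨
      ι (k ℕ.+ 2)    ≡⟨ ι-+ k 2 ⟩
      ι k + ι 2      ≤⟨ +-monoˡ-≤ (ι 2) k≤x′y′ ⟩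
      x′ * y′ + ι 2  <⟨ x′y′+2<c ⟩
      ι c            ∎)

open RealBound using (bound-below)

open import Data.Nat using (_+_; _*_; _∸_; _^_; _≤_; _<_; z≤n; s≤s; s≤s⁻¹; _≤?_; pred; NonZero)
open import Algebra.Properties.Semiring.Sum ℕ.+-*-semiring using (sum; sum-cong-≗; sum-permute; ∑-distrib-+; *-distribʳ-sum)
open import Data.Nat.DivMod using (_/_; _%_; m≡m%n+[m/n]*n; m%n<n; m/n*n≤m)
open import Data.Nat.Properties hiding (_≟_)

-- Counting

sum-mono-≤ : {f g : Fin n → ℕ} → (∀ i → f i ≤ g i) → sum f ≤ sum g
sum-mono-≤ {n = zero}  f≤g = z≤n
sum-mono-≤ {n = suc n} f≤g = +-mono-≤ (f≤g zero) (sum-mono-≤ (f≤g ∘ suc))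

sum-mono-< : {f g : Fin n → ℕ} → (∀ i → f i ≤ g i) → ∀ i → f i < g i → sum f < sum g
sum-mono-< f≤g zero    f<g = +-mono-<-≤ f<g (sum-mono-≤ (f≤g ∘ suc))
sum-mono-< f≤g (suc i) f<g = +-mono-≤-< (f≤g zero) (sum-mono-< (f≤g ∘ suc) i f<g)

sum-const : ∀ n c → sum {n} (λ _ → c) ≡ n * c
sum-const zero    c = refl
sum-const (suc n) c = cong (c +_) (sum-const n c)

-- Reads the decision through `does`, as `filter` does, so that counts and lengths of filtered lists
-- unfold together.
𝟙 : Dec A → ℕ
𝟙 A? = if does A? then 1 else 0

𝟙-yes : (A? : Dec A) → A → 𝟙 A? ≡ 1
𝟙-yes (yes _) x = refl
𝟙-yes (no ¬x) x = contradiction x ¬x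

𝟙-no : (A? : Dec A) → ¬ A → 𝟙 A? ≡ 0
𝟙-no (yes x) ¬x = contradiction x ¬x
𝟙-no (no _)  ¬x = refl

𝟙≤1 : (A? : Dec A) → 𝟙 A? ≤ 1
𝟙≤1 (yes _) = ≤-refl
𝟙≤1 (no _)  = z≤n

𝟙-mono : (A? : Dec A) (B? : Dec B) → (A → B) → 𝟙 A? ≤ 𝟙 B?
𝟙-mono (yes x) B? f = ≤-reflexive (sym (𝟙-yes B? (f x)))
𝟙-mono (no _)  B? f = z≤n

count : {P : Pred (Fin n) p} → Decidable P → ℕ
count P? = sum (𝟙 ∘ P?)

module _ {P : Pred (Fin n) p} {Q : Pred (Fin n) q} (P? : Decidable P) (Q? : Decidable Q) where

  count-mono-≤ : P ⊆ Q → count P? ≤ count Q?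
  count-mono-≤ P⊆Q = sum-mono-≤ (λ i → 𝟙-mono (P? i) (Q? i) P⊆Q)

  count-mono-< : P ⊆ Q → ∀ i → ¬ P i → Q i → count P? < count Q?
  count-mono-< P⊆Q i ¬Pi Qi = sum-mono-< (λ i → 𝟙-mono (P? i) (Q? i) P⊆Q) i
    (subst₂ _<_ (sym (𝟙-no (P? i) ¬Pi)) (sym (𝟙-yes (Q? i) Qi)) ≤-refl)

count-∪ : ∀ {r} {P : Pred (Fin n) p} {Q : Pred (Fin n) q} {R : Pred (Fin n) r}
          (P? : Decidable P) (Q? : Decidable Q) (R? : Decidable R) →
          (∀ i → P i → ¬ Q i → R i) → count P? ≤ count R? + count Q?
count-∪ P? Q? R? split = ≤-trans (sum-mono-≤ (λ i → pointwise (P? i) (Q? i) (R? i) (split i)))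
                                 (≤-reflexive (∑-distrib-+ (𝟙 ∘ R?) (𝟙 ∘ Q?)))
  where
  pointwise : ∀ {r} {C : Set r} (A? : Dec A) (B? : Dec B) (C? : Dec C) →
              (A → ¬ B → C) → 𝟙 A? ≤ 𝟙 C? + 𝟙 B?
  pointwise (no _)  B?       C? f = z≤n
  pointwise (yes x) (yes _)  C? f = m≤n+m 1 (𝟙 C?)
  pointwise (yes x) (no ¬y)  C? f = ≤-trans (≤-reflexive (sym (𝟙-yes C? (f x ¬y)))) (m≤m+n _ 0)

count<n : {P : Pred (Fin n) p} (P? : Decidable P) → ∀ i → ¬ P i → count P? < n
count<n {n = n} P? i ¬Pi = <-≤-trans
  (sum-mono-< (λ i → 𝟙≤1 (P? i)) i (subst (_< 1) (sym (𝟙-no (P? i) ¬Pi)) ≤-refl))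
  (≤-reflexive (trans (sum-const n 1) (*-identityʳ n)))

length-filter-∷ : {P : Pred A p} (P? : Decidable P) → ∀ x xs →
                  length (filter P? (x ∷ xs)) ≡ 𝟙 (P? x) + length (filter P? xs)
length-filter-∷ P? x xs with does (P? x)
... | true  = refl
... | false = refl

length-filter-tabulate : {P : Pred A p} (P? : Decidable P) (f : Fin n → A) →
                         length (filter P? (tabulate f)) ≡ count (P? ∘ f)
length-filter-tabulate {n = zero}  P? f = refl
length-filter-tabulate {n = suc n} P? f =
  trans (length-filter-∷ P? (f zero) _) (cong (𝟙 (P? (f zero)) +_) (length-filter-tabulate P? (f ∘ suc)))

length-filter-split : {P : Pred A p} (P? : Decidable P) → ∀ xs →
                      length (filter P? xs) + length (filter (¬? ∘ P?) xs) ≡ length xs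
length-filter-split P? []       = refl
length-filter-split P? (x ∷ xs) with ih ← length-filter-split P? xs | does (P? x)
... | true  = cong suc ih
... | false = trans (+-suc _ _) (cong suc ih)

-- The right side counts the related pairs by their first component; counted by the second, each
-- entry of `xs` contributes at least `c`.
double-counting : {R : Fin n → A → Set p} (R? : ∀ i x → Dec (R i x)) → ∀ {c xs} →
                  All (λ x → c ≤ count (λ i → R? i x)) xs →
                  length xs * c ≤ sum (λ i → length (filter (R? i) xs))
double-counting R? [] = z≤n
double-counting R? {c} {x ∷ xs} (c≤ ∷ all) = begin
  c + length xs * c                                          ≤⟨ +-mono-≤ c≤ (double-counting R? all) ⟩
  count (λ i → R? i x) + sum (λ i → length (filter (R? i) xs))
    ≡⟨ ∑-distrib-+ _ (λ i → length (filter (R? i) xs)) ⟨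
  sum (λ i → 𝟙 (R? i x) + length (filter (R? i) xs))
    ≡⟨ sum-cong-≗ (λ i → length-filter-∷ (R? i) x xs) ⟨
  sum (λ i → length (filter (R? i) (x ∷ xs)))                ∎
  where open ≤-Reasoning

-- Arithmetic

module Estimates where
  open ≤-Reasoning

  private
    swap : ∀ a b c → a * (b * c) ≡ b * (a * c)
    swap = solve-∀

  -- The second-order part of (1 + 1/f)ʲ, cleared of denominators.
  binomial-bound : ∀ f j → (2 * (f * f) + 2 * (f * j) + j * pred j) * f ^ j ≤ 2 * (f * f) * suc f ^ j
  binomial-bound f zero = ≤-reflexive (lem f)
    where lem : ∀ f → (2 * (f * f) + 2 * (f * 0) + 0) * 1 ≡ 2 * (f * f) * 1
          lem = solve-∀
  binomial-bound f (suc j) = begin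
    (2 * (f * f) + 2 * (f * suc j) + suc j * j) * (f * x)  ≡⟨ *-assoc (2 * (f * f) + 2 * (f * suc j) + suc j * j) f x ⟨
    (2 * (f * f) + 2 * (f * suc j) + suc j * j) * f * x    ≤⟨ *-monoˡ-≤ x (≤-trans (m≤m+n _ (j * pred j)) (≤-reflexive (step j))) ⟩
    suc f * (2 * (f * f) + 2 * (f * j) + j * pred j) * x   ≡⟨ *-assoc (suc f) (2 * (f * f) + 2 * (f * j) + j * pred j) x ⟩
    suc f * ((2 * (f * f) + 2 * (f * j) + j * pred j) * x) ≤⟨ *-monoʳ-≤ (suc f) (binomial-bound f j) ⟩
    suc f * (2 * (f * f) * suc f ^ j)                      ≡⟨ swap (suc f) (2 * (f * f)) (suc f ^ j) ⟩
    2 * (f * f) * (suc f * suc f ^ j)                      ∎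
    where
    x = f ^ j
    step₀ : ∀ f → (2 * (f * f) + 2 * (f * 1) + 0) * f + 0 ≡ suc f * (2 * (f * f) + 2 * (f * 0) + 0)
    step₀ = solve-∀
    step₁ : ∀ f i → (2 * (f * f) + 2 * (f * (2 + i)) + (2 + i) * (1 + i)) * f + (1 + i) * i ≡
                    suc f * (2 * (f * f) + 2 * (f * (1 + i)) + (1 + i) * i)
    step₁ = solve-∀
    step : ∀ j → (2 * (f * f) + 2 * (f * suc j) + suc j * j) * f + j * pred j ≡
                 suc f * (2 * (f * f) + 2 * (f * j) + j * pred j)
    step zero    = step₀ f
    step (suc i) = step₁ f i

  -- For f = 2 + g and k = f + j this is 4 (k - 1)² fʲ ≤ 7 (f - 1) (f + 1)ʲ⁺¹.
  Estimate : ℕ → ℕ → Set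
  Estimate g j = 4 * ((1 + g + j) * (1 + g + j)) * (2 + g) ^ j ≤ 7 * (1 + g) * (3 + g) ^ suc j

  -- For g ≥ 1 `binomial-bound` reduces this to a polynomial inequality in h = g - 1, whose slack
  -- `rest` has nonnegative coefficients. At g = 0 the second-order bound is too weak, and the
  -- numbers are compared directly.
  estimate-mid : ∀ g → Estimate g (4 + g)
  estimate-mid zero    = ≤ᵇ⇒≤ 1600 1701 _
  estimate-mid (suc h) = ≤-trans
    (transfer (2 * (f * f)) (4 * (N * N)) (7 * (2 + h) * suc f) (2 * (f * f) + 2 * (f * j) + j * pred j) (f ^ j) (suc f ^ j)
      (binomial-bound f j) (≤-trans (m≤m+n _ rest) (≤-reflexive (poly h))))
    (≤-reflexive (*-assoc (7 * (2 + h)) (suc f) (suc f ^ j)))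
    where
    f = 3 + h
    j = 5 + h
    N = 2 + h + j
    rest = 3 * (h * (h * (h * h))) + 53 * (h * (h * h)) + 286 * (h * h) + 560 * h + 280
    poly : ∀ h → 2 * ((3 + h) * (3 + h)) * (4 * ((2 + h + (5 + h)) * (2 + h + (5 + h)))) +
                 (3 * (h * (h * (h * h))) + 53 * (h * (h * h)) + 286 * (h * h) + 560 * h + 280) ≡
                 7 * (2 + h) * (4 + h) * (2 * ((3 + h) * (3 + h)) + 2 * ((3 + h) * (5 + h)) + (5 + h) * (4 + h))
    poly = solve-∀
    transfer : ∀ q a c b x y .{{_ : NonZero q}} → b * x ≤ q * y → q * a ≤ c * b → a * x ≤ c * y
    transfer q a c b x y bx≤qy qa≤cb = *-cancelˡ-≤ q (begin
      q * (a * x) ≡⟨ *-assoc q a x ⟨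
      q * a * x   ≤⟨ *-monoˡ-≤ x qa≤cb ⟩
      c * b * x   ≡⟨ *-assoc c b x ⟩
      c * (b * x) ≤⟨ *-monoʳ-≤ c bx≤qy ⟩
      c * (q * y) ≡⟨ swap c q y ⟩
      q * (c * y) ∎)

  module _ (g j : ℕ) where
    private
      f = 2 + g
      N = 1 + g + j
      x = f ^ j
      y = 7 * (1 + g)
      z = suc f ^ suc j

      expand : ∀ f N → f * (suc N * suc N) + N * N ≡ suc f * (N * N) + ((f + f) * N + f)
      expand = solve-∀
      inner : ∀ a b c → 4 * a * (b * c) ≡ 4 * (b * a) * c
      inner = solve-∀
      outer : ∀ a b c → 4 * (b * a) * c ≡ b * (4 * a * c)
      outer = solve-∀

    -- Raising j multiplies the left side by f(N + 1)²/N² and the right side by f + 1. The first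
    -- factor is the smaller once 2fN + f ≤ N², which follows from 2f + 1 ≤ N.
    estimate-up : suc f + f ≤ N → Estimate g j → Estimate g (suc j)
    estimate-up 2f<N est = begin
      4 * ((1 + g + suc j) * (1 + g + suc j)) * (f * x)  ≡⟨ cong (λ M → 4 * (M * M) * (f * x)) (+-suc (1 + g) j) ⟩
      4 * (suc N * suc N) * (f * x)                      ≡⟨ inner (suc N * suc N) f x ⟩
      4 * (f * (suc N * suc N)) * x                      ≤⟨ *-monoˡ-≤ x (*-monoʳ-≤ 4 growth) ⟩
      4 * (suc f * (N * N)) * x                          ≡⟨ outer (N * N) (suc f) x ⟩
      suc f * (4 * (N * N) * x)                          ≤⟨ *-monoʳ-≤ (suc f) est ⟩
      suc f * (y * z)                                    ≡⟨ swap (suc f) y z ⟩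
      y * (suc f * z)                                    ∎
      where
      growth : f * (suc N * suc N) ≤ suc f * (N * N)
      growth = +-cancelʳ-≤ (N * N) _ _ (begin
        f * (suc N * suc N) + N * N          ≡⟨ expand f N ⟩
        suc f * (N * N) + ((f + f) * N + f)  ≤⟨ +-monoʳ-≤ (suc f * (N * N)) (+-monoʳ-≤ ((f + f) * N) (≤-trans (m≤n+m f (suc f)) 2f<N)) ⟩
        suc f * (N * N) + ((f + f) * N + N)  ≡⟨ cong (suc f * (N * N) +_) (+-comm ((f + f) * N) N) ⟩
        suc f * (N * N) + (suc f + f) * N    ≤⟨ +-monoʳ-≤ (suc f * (N * N)) (*-monoˡ-≤ N 2f<N) ⟩
        suc f * (N * N) + N * N              ∎)

    -- For N ≤ 2f the comparison of the two factors is reversed, because N² ≤ 2fN; so the estimate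
    -- passes from j + 1 down to j.
    estimate-down : N ≤ f + f → Estimate g (suc j) → Estimate g j
    estimate-down N≤2f est = *-cancelˡ-≤ (suc f) (begin
      suc f * (4 * (N * N) * x)                          ≡⟨ outer (N * N) (suc f) x ⟨
      4 * (suc f * (N * N)) * x                          ≤⟨ *-monoˡ-≤ x (*-monoʳ-≤ 4 growth) ⟩
      4 * (f * (suc N * suc N)) * x                      ≡⟨ inner (suc N * suc N) f x ⟨
      4 * (suc N * suc N) * (f * x)                      ≡⟨ cong (λ M → 4 * (M * M) * (f * x)) (+-suc (1 + g) j) ⟨
      4 * ((1 + g + suc j) * (1 + g + suc j)) * (f * x)  ≤⟨ est ⟩
      y * (suc f * z)                                    ≡⟨ swap y (suc f) z ⟩
      suc f * (y * z)                                    ∎)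
      where
      growth : suc f * (N * N) ≤ f * (suc N * suc N)
      growth = +-cancelʳ-≤ (N * N) _ _ (begin
        suc f * (N * N) + N * N              ≤⟨ +-monoʳ-≤ (suc f * (N * N)) (*-monoˡ-≤ N N≤2f) ⟩
        suc f * (N * N) + (f + f) * N        ≤⟨ +-monoʳ-≤ (suc f * (N * N)) (m≤m+n _ f) ⟩
        suc f * (N * N) + ((f + f) * N + f)  ≡⟨ expand f N ⟨
        f * (suc N * suc N) + N * N          ∎)

  -- As j varies, the ratio of the two sides is least near j = 4 + g.
  estimate : ∀ g j → Estimate g j
  estimate g j with ≤-total j (4 + g)
  ... | inj₁ j≤ = down (4 + g ∸ j) j (m+[n∸m]≡n j≤)
    where
    down : ∀ m j → j + m ≡ 4 + g → Estimate g j
    down zero    j eq = subst (Estimate g) (trans (sym eq) (+-identityʳ j)) (estimate-mid g)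
    down (suc m) j eq = estimate-down g j (begin
      1 + g + j              ≤⟨ +-monoʳ-≤ (1 + g) (s≤s⁻¹ (≤-trans (m≤m+n (suc j) m) (≤-reflexive (trans (sym (+-suc j m)) eq)))) ⟩
      1 + g + (3 + g)        ≡⟨ +-suc (1 + g) (2 + g) ⟩
      2 + g + (2 + g)        ∎) (down m (suc j) (trans (sym (+-suc j m)) eq))
  ... | inj₂ j≥ = subst (Estimate g) (m∸n+n≡m j≥) (up (j ∸ (4 + g)))
    where
    up : ∀ m → Estimate g (m + (4 + g))
    up zero    = estimate-mid g
    up (suc m) = estimate-up g (m + (4 + g)) (begin
      3 + g + (2 + g)          ≡⟨ move g ⟩
      1 + g + (4 + g)          ≤⟨ +-monoʳ-≤ (1 + g) (m≤n+m (4 + g) m) ⟩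
      1 + g + (m + (4 + g))    ∎) (up m)
      where
      move : ∀ g → 3 + g + (2 + g) ≡ 1 + g + (4 + g)
      move = solve-∀

  -- Take f = ⌊n/t⌋ + 1. Then n ≤ f t, while (f - 1) t ≤ n lets `estimate` turn 7n < 4k² into the
  -- exponential inequality after cancelling 7(f - 1).
  parameters : ∀ n t k → t ≤ n → suc k < t → 7 * n < 4 * (k * k) →
               ∃[ f ] ∃[ j ] j + f ≡ suc k × n ≤ f * t × t * f ^ j < suc f ^ suc j
  parameters n t@(suc _) k t≤n k<t 7n<4k² with n / t | m/n*n≤m n t | m≡m%n+[m/n]*n n t
  ... | zero  | _     | n≡ = contradiction t≤n (<⇒≱ (subst (_< t) (sym (trans n≡ (+-identityʳ _))) (m%n<n n t)))
  ... | suc g | q*t≤n | n≡ = 2 + g , j , trans (+-comm j (2 + g)) (cong suc k≡) , n≤ , bound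
    where
    -- Serves to show 1 + g ≤ k, so that the truncated subtraction defining `j` is exact.
    7g<4k : 7 * (1 + g) < 4 * k
    7g<4k = *-cancelʳ-< k _ _ (begin-strict
      7 * (1 + g) * k   ≡⟨ *-assoc 7 (1 + g) k ⟩
      7 * ((1 + g) * k) ≤⟨ *-monoʳ-≤ 7 (*-monoʳ-≤ (1 + g) (<⇒≤ (<-trans (n<1+n k) k<t))) ⟩
      7 * ((1 + g) * t) ≤⟨ *-monoʳ-≤ 7 q*t≤n ⟩
      7 * n             <⟨ 7n<4k² ⟩
      4 * (k * k)       ≡⟨ *-assoc 4 k k ⟨
      4 * k * k         ∎)
    g<k : 1 + g ≤ k
    g<k = *-cancelˡ-≤ 4 (≤-trans (*-monoˡ-≤ (1 + g) (≤ᵇ⇒≤ 4 7 _)) (<⇒≤ 7g<4k))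
    j = k ∸ (1 + g)
    k≡ : 1 + g + j ≡ k
    k≡ = m+[n∸m]≡n g<k
    n≤ : n ≤ (2 + g) * t
    n≤ = ≤-trans (≤-reflexive n≡) (+-monoˡ-≤ _ (<⇒≤ (m%n<n n t)))
    x = (2 + g) ^ j
    instance
      x≢0 : NonZero x
      x≢0 = m^n≢0 (2 + g) j
    rearrange : ∀ c t x → 7 * c * (t * x) ≡ 7 * (c * t) * x
    rearrange = solve-∀
    bound : t * x < (3 + g) ^ suc j
    bound = *-cancelˡ-< (7 * (1 + g)) _ _ (begin-strict
      7 * (1 + g) * (t * x)   ≡⟨ rearrange (1 + g) t x ⟩
      7 * ((1 + g) * t) * x   ≤⟨ *-monoˡ-≤ x (*-monoʳ-≤ 7 q*t≤n) ⟩
      7 * n * x               <⟨ *-monoˡ-< x 7n<4k² ⟩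
      4 * (k * k) * x         ≡⟨ cong (λ M → 4 * (M * M) * x) k≡ ⟨
      4 * ((1 + g + j) * (1 + g + j)) * x ≤⟨ estimate g j ⟩
      7 * (1 + g) * (3 + g) ^ suc j ∎)

open Estimates using (parameters)

-- The pursuit on differences

module Pursuit
  {n} {_∙_ : Op₂ (Fin n)} {ε : Fin n} {_⁻¹ : Op₁ (Fin n)}
  (isAbelianGroup : IsAbelianGroup _≡_ _∙_ ε _⁻¹)
  {T : Pred (Fin n) 0ℓ} (T? : Decidable T) (T-ε : T ε)
  where

  private
    group : AbelianGroup 0ℓ 0ℓ
    group = record { isAbelianGroup = isAbelianGroup }

  open AbelianGroup group using (assoc; identityˡ; identityʳ; commutativeMonoid)
  open AbelianGroupProperties group using (∙-cancelˡ; xyx⁻¹≈y; ⁻¹-anti-homo‿-; //-rightDividesˡ; //-rightDividesʳ)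
  open Mult (AbelianGroup.monoid group) renaming (_×_ to _·_) using (×-homo-+; ×-assocˡ)
  open CommutativeMonoidSolver commutativeMonoid using (solve; _⊕_; _⊜_)

  -- Multiples of an element and quotients by them

  ·-ε : ∀ m → m · ε ≡ ε
  ·-ε zero    = refl
  ·-ε (suc m) = trans (identityˡ _) (·-ε m)

  -- Two of the n + 1 multiples 0·a, ..., n·a coincide. The period is kept in the form `suc o` so
  -- that remainders modulo it are defined.
  finite-order : ∀ a → ∃[ o ] suc o · a ≡ ε
  finite-order a with i , j , i<j , eq ← pigeonhole (n<1+n n) (λ i → toℕ i · a)
                 with o , i+o≡j ← m≤n⇒∃[o]m+o≡n i<j
    = o , ∙-cancelˡ (toℕ i · a) _ _ (begin
      (toℕ i · a) ∙ (suc o · a) ≡⟨ ×-homo-+ a (toℕ i) (suc o) ⟨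
      (toℕ i + suc o) · a       ≡⟨ cong (_· a) (trans (+-suc (toℕ i) o) i+o≡j) ⟩
      toℕ j · a                 ≡⟨ eq ⟨
      toℕ i · a                 ≡⟨ identityʳ _ ⟨
      (toℕ i · a) ∙ ε           ∎)
    where open ≡-Reasoning

  ·-reduce : ∀ a o → suc o · a ≡ ε → ∀ m → m · a ≡ (m % suc o) · a
  ·-reduce a o oa≡ε m = begin
    m · a                                          ≡⟨ cong (_· a) (m≡m%n+[m/n]*n m (suc o)) ⟩
    (m % suc o + m / suc o * suc o) · a            ≡⟨ ×-homo-+ a (m % suc o) _ ⟩
    ((m % suc o) · a) ∙ ((m / suc o * suc o) · a)  ≡⟨ cong (((m % suc o) · a) ∙_) (×-assocˡ a (m / suc o) (suc o)) ⟨
    ((m % suc o) · a) ∙ ((m / suc o) · suc o · a)  ≡⟨ cong (λ x → ((m % suc o) · a) ∙ ((m / suc o) · x)) oa≡ε ⟩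
    ((m % suc o) · a) ∙ ((m / suc o) · ε)          ≡⟨ cong (((m % suc o) · a) ∙_) (·-ε (m / suc o)) ⟩
    ((m % suc o) · a) ∙ ε                          ≡⟨ identityʳ _ ⟩
    (m % suc o) · a                                ∎
    where open ≡-Reasoning

  -- A quotient of the group, given by its decidable kernel relation.
  record Congruence : Set₁ where
    infix 4 _~_
    field
      _~_              : Rel (Fin n) 0ℓ
      isDecEquivalence : IsDecEquivalence _~_
      ∙-congʳ~         : ∀ z {x y} → x ~ y → (x ∙ z) ~ (y ∙ z)

    open IsDecEquivalence isDecEquivalence public
      renaming (refl to ~-refl; sym to ~-sym; trans to ~-trans; _≟_ to _~?_; reflexive to ~-reflexive)

    ~-decSetoid : DecSetoid 0ℓ 0ℓ
    ~-decSetoid = record { isDecEquivalence = isDecEquivalence }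

    IsTrivial : Set
    IsTrivial = ∀ x → x ~ ε

    T̄ : Pred (Fin n) 0ℓ
    T̄ x = ∃[ t ] T t × x ~ t

    T̄? : Decidable T̄
    T̄? x = any? (λ t → T? t ×-dec (x ~? t))

  discrete : Congruence
  discrete = record { _~_ = _≡_ ; isDecEquivalence = ≡.isDecEquivalence _≟_ ; ∙-congʳ~ = λ z → cong (_∙ z) }

  -- Factors out the cyclic subgroup of `a` as well. Nonnegative multiples suffice, as `a` has
  -- finite order.
  adjoin : Congruence → Fin n → Congruence
  adjoin C a = record
    { _~_              = _~′_
    ; isDecEquivalence = record
      { isEquivalence = record { refl = ~′-refl ; sym = ~′-sym ; trans = ~′-trans }
      ; _≟_ = _~′?_
      }
    ; ∙-congʳ~         = λ z {x} {y} (m , eq) → m , subst (_~ (y ∙ z)) (swap x (m · a) z) (∙-congʳ~ z eq)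
    }
    where
    open Congruence C
    _~′_ : Rel (Fin n) 0ℓ
    x ~′ y = ∃[ m ] (x ∙ (m · a)) ~ y

    swap : ∀ x y z → (x ∙ y) ∙ z ≡ (x ∙ z) ∙ y
    swap = solve 3 (λ x y z → (x ⊕ y) ⊕ z ⊜ (x ⊕ z) ⊕ y) refl

    o = proj₁ (finite-order a)
    oa≡ε = proj₂ (finite-order a)

    ~′-refl : ∀ {x} → x ~′ x
    ~′-refl = 0 , ~-reflexive (identityʳ _)

    ~′-sym : ∀ {x y} → x ~′ y → y ~′ x
    -- The multiple `m * o` inverts `m`, because m + m o = m (1 + o) is divisible by the period.
    ~′-sym {x} {y} (m , eq) = m * o , ~-trans (∙-congʳ~ ((m * o) · a) (~-sym eq)) (~-reflexive (begin
      (x ∙ (m · a)) ∙ ((m * o) · a)  ≡⟨ assoc _ _ _ ⟩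
      x ∙ ((m · a) ∙ ((m * o) · a))  ≡⟨ cong (x ∙_) (×-homo-+ a m (m * o)) ⟨
      x ∙ ((m + m * o) · a)          ≡⟨ cong (λ k → x ∙ (k · a)) (*-suc m o) ⟨
      x ∙ ((m * suc o) · a)          ≡⟨ cong (x ∙_) (×-assocˡ a m (suc o)) ⟨
      x ∙ (m · suc o · a)            ≡⟨ cong (λ y → x ∙ (m · y)) oa≡ε ⟩
      x ∙ (m · ε)                    ≡⟨ cong (x ∙_) (·-ε m) ⟩
      x ∙ ε                          ≡⟨ identityʳ x ⟩
      x                              ∎))
      where open ≡-Reasoning

    ~′-trans : ∀ {x y z} → x ~′ y → y ~′ z → x ~′ z
    ~′-trans {x} {y} {z} (m , p) (k , q) = m + k , ~-trans (~-reflexive (begin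
      x ∙ ((m + k) · a)        ≡⟨ cong (x ∙_) (×-homo-+ a m k) ⟩
      x ∙ ((m · a) ∙ (k · a))  ≡⟨ assoc _ _ _ ⟨
      (x ∙ (m · a)) ∙ (k · a)  ∎)) (~-trans (∙-congʳ~ (k · a) p) q)
      where open ≡-Reasoning

    _~′?_ : ∀ x y → Dec (x ~′ y)
    -- Multiples of `a` repeat with period `suc o`, so a search below it decides the relation.
    x ~′? y = map′ (λ (m , eq) → toℕ m , eq) bounded (any? {suc o} (λ m → (x ∙ (toℕ m · a)) ~? y))
      where
      bounded : x ~′ y → ∃[ m ] (x ∙ (toℕ {suc o} m · a)) ~ y
      bounded (m , eq) = fromℕ< (m%n<n m (suc o)) , subst (λ z → (x ∙ z) ~ y)
        (trans (·-reduce a o oa≡ε m) (cong (_· a) (sym (toℕ-fromℕ< (m%n<n m (suc o)))))) eq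

  module _ (C : Congruence) (a : Fin n) where
    open Congruence C
    open Congruence (adjoin C a) using () renaming (_~_ to _~′_)

    adjoin-⊇ : ∀ {x y} → x ~ y → x ~′ y
    adjoin-⊇ x~y = 0 , ~-trans (~-reflexive (identityʳ _)) x~y

    adjoin-∋ : a ~′ ε
    adjoin-∋ with o , oa≡ε ← finite-order a = o , ~-reflexive oa≡ε

  -- Cop i has difference `d i` from the robber.  `Forces C M d`: against a
  -- robber moving only by elements of M, the cops bring some difference into
  -- the trivial class of C.
  data Forces (C : Congruence) (M : Pred (Fin n) 0ℓ) {k} (d : Fin k → Fin n) : Set where
    caught : ∀ i → Congruence._~_ C (d i) ε → Forces C M d
    round  : (d′ : ∀ s → M s → Fin k → Fin n) →
             (∀ s (Ms : M s) i → ∃[ t ] T t × d′ s Ms i ∙ t ≡ d i ∙ s) →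
             (∀ s (Ms : M s) → Forces C M (d′ s Ms)) →
             Forces C M d

  Win : Congruence → Pred (Fin n) 0ℓ → ℕ → Set
  Win C M k = ∀ (d : Fin k → Fin n) → Forces C M d

  -- Grafts a second strategy onto every leaf of the first.
  continue : ∀ {C C′ M k} {d : Fin k → Fin n} → Forces C M d →
             (∀ d i → Congruence._~_ C (d i) ε → Forces C′ M d) → Forces C′ M d
  continue (caught i eq)         f = f _ i eq
  continue (round d′ moves next) f = round d′ moves (λ s Ms → continue (next s Ms) f)

  -- The moves answered by a cop whose difference is to be increased by a.
  Guarded : Congruence → Fin n → Pred (Fin n) 0ℓ
  Guarded C a s = Congruence.T̄ C (s ∙ (a ⁻¹))

  -- Guarding with one cop

  module Guarding (C : Congruence) (M : Pred (Fin n) 0ℓ) (M⊆T : ∀ {s} → M s → T s) (a : Fin n) where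
    open Congruence C

    Unguarded : Pred (Fin n) 0ℓ
    Unguarded s = M s × ¬ Guarded C a s

    private
      moves : ∀ {k} {d : Fin (suc k) → Fin n} {s} (e : Fin k → Fin n) i c →
              (∃[ t ] T t × c ∙ t ≡ d i ∙ s) →
              (∀ l → ∃[ t ] T t × e l ∙ t ≡ d (punchIn i l) ∙ s) →
              ∀ x → ∃[ t ] T t × insertAt e i c x ∙ t ≡ d x ∙ s
      moves {d = d} {s} e i c (t , Tt , eq) rest x with i ≟ x
      ... | yes refl = t , Tt , trans (cong (_∙ t) (insertAt-lookup e i c)) eq
      ... | no i≢x = subst (λ x → ∃[ t ] T t × insertAt e i c x ∙ t ≡ d x ∙ s) (punchIn-punchOut i≢x)
        (let l = punchOut i≢x ; u , Tu , eq = rest l in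
         u , Tu , trans (cong (_∙ u) (insertAt-punchIn e i c l)) eq)

    module _ {k} (win : Win C Unguarded k) where
      -- Here `m` is the number of guarded moves after which cop `i` succeeds. A guarded move lowers
      -- `m`; an unguarded one descends in the strategy of the other cops. The recursion is
      -- lexicographic in these two.
      guard : ∀ m (d : Fin (suc k) → Fin n) i → (d i ∙ (m · a)) ~ ε → Forces C M d
      -- The other cops' differences are a separate `e`, since removing entry `i` after `insertAt`
      -- gives back `e` only pointwise.
      play  : ∀ m (d : Fin (suc k) → Fin n) i → (d i ∙ (suc m · a)) ~ ε →
              (e : Fin k → Fin n) → (∀ l → d (punchIn i l) ≡ e l) → Forces C Unguarded e → Forces C M d

      guard zero    d i eq = caught i (subst (_~ ε) (identityʳ (d i)) eq)
      guard (suc m) d i eq = play m d i eq (removeAt d i) (λ _ → refl) (win (removeAt d i))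

      play m d i eq e d≡e (caught l el~ε) = caught (punchIn i l) (subst (_~ ε) (sym (d≡e l)) el~ε)
      play m d i eq e d≡e (round e′ e-moves next) =
        round (λ s Ms → proj₁ (answer s Ms)) (λ s Ms → proj₁ (proj₂ (answer s Ms))) (λ s Ms → proj₂ (proj₂ (answer s Ms)))
        where
        answer : ∀ s → M s → ∃[ d′ ] (∀ x → ∃[ t ] T t × d′ x ∙ t ≡ d x ∙ s) × Forces C M d′
        answer s Ms with T̄? (s ∙ (a ⁻¹))
        ... | no ¬Gs = insertAt (e′ s Us) i (d i) ,
                       moves (e′ s Us) i (d i) (s , M⊆T Ms , refl)
                         (λ l → let t , Tt , eq = e-moves s Us l in t , Tt , trans eq (cong (_∙ s) (sym (d≡e l)))) ,
                       play m _ i (subst (λ c → (c ∙ (suc m · a)) ~ ε) (sym (insertAt-lookup (e′ s Us) i (d i))) eq)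
                         (e′ s Us) (insertAt-punchIn (e′ s Us) i (d i)) (next s Us)
          where Us = Ms , ¬Gs
        -- Cop `i` plays `t`, which adds `a` to its difference modulo `C`; the others copy `s` and
        -- begin their strategy afresh.
        ... | yes (t , Tt , s-a~t) = insertAt e i c ,
                       moves e i c (t , Tt , //-rightDividesˡ t _)
                         (λ l → s , M⊆T Ms , cong (_∙ s) (sym (d≡e l))) ,
                       guard m _ i (subst (λ c → (c ∙ (m · a)) ~ ε) (sym (insertAt-lookup e i c)) c∙ma~ε)
          where
          c = (d i ∙ s) ∙ (t ⁻¹)
          shuffle : ∀ d s x m → ((d ∙ s) ∙ x) ∙ m ≡ (s ∙ x) ∙ (d ∙ m)
          shuffle = solve 4 (λ d s x m → ((d ⊕ s) ⊕ x) ⊕ m ⊜ (s ⊕ x) ⊕ (d ⊕ m)) refl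
          shuffle′ : ∀ a d m → a ∙ (d ∙ m) ≡ d ∙ (a ∙ m)
          shuffle′ = solve 3 (λ a d m → a ⊕ (d ⊕ m) ⊜ d ⊕ (a ⊕ m)) refl
          s~at : s ~ (t ∙ a)
          s~at = subst (_~ (t ∙ a)) (//-rightDividesˡ a s) (∙-congʳ~ a s-a~t)
          s-t~a : (s ∙ (t ⁻¹)) ~ a
          s-t~a = subst ((s ∙ (t ⁻¹)) ~_) (xyx⁻¹≈y t a) (∙-congʳ~ (t ⁻¹) s~at)
          c∙ma~ε : (c ∙ (m · a)) ~ ε
          c∙ma~ε = subst (_~ ε) (sym (shuffle (d i) s (t ⁻¹) (m · a)))
            (~-trans (∙-congʳ~ (d i ∙ (m · a)) s-t~a)
              (~-trans (~-reflexive (shuffle′ a (d i) (m · a))) eq))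

      -- The quotient strategy ends with some `d i` that a multiple of `a` brings into the trivial
      -- class of `C`, which is where a guard can start.
      guarding : Win (adjoin C a) M (suc k) → Win C M (suc k)
      guarding win′ d = continue (win′ d) (λ d i (m , eq) → guard m d i eq)

  -- Lists of robber moves and the ascent through quotients

  Covers : Congruence → Pred (Fin n) 0ℓ → List (Fin n) → Set
  Covers C M U = ∀ {s} → M s → Any (Congruence._~_ C s) U

  -- The robber has no admissible move, so a round answering all of them exists vacuously.
  win-∅ : ∀ {C M} k → Covers C M [] → Win C M k
  win-∅ k cov d = round (λ s Ms → impossible Ms) (λ s Ms → impossible Ms) (λ s Ms → impossible Ms)
    where
    impossible : ∀ {a} {A : Set a} {s} → _ → A
    impossible {s = s} Ms with () ← cov {s} Ms

  module Climbing {M : Pred (Fin n) 0ℓ} (M⊆T : ∀ {s} → M s → T s) {U : List (Fin n)} {k : ℕ} where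
    open Congruence
    open Guarding

    module _ (step : ∀ C → Covers C M U →
                     Win C M (suc k) ⊎ (∃[ a ] ¬ _~_ C a ε × Win C (Unguarded C M M⊆T a) k)) where

      -- The fuel bounds the number of elements outside the trivial class.
      climb : ∀ fuel C → n ≤ fuel + count (λ x → _~?_ C x ε) → Covers C M U → Win C M (suc k)
      climb fuel C n≤ cov with step C cov
      ... | inj₁ win = win
      climb zero C n≤ cov | inj₂ (a , a≁ε , _) = contradiction n≤ (<⇒≱ (count<n (λ x → _~?_ C x ε) a a≁ε))
      climb (suc fuel) C n≤ cov | inj₂ (a , a≁ε , win) =
        guarding C M M⊆T a win (climb fuel (adjoin C a) n≤′ (Any.map (adjoin-⊇ C a) ∘ cov))
        where
        n≤′ : n ≤ fuel + count (λ x → _~?_ (adjoin C a) x ε)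
        n≤′ = ≤-trans n≤ (≤-trans (≤-reflexive (sym (+-suc fuel _))) (+-monoʳ-≤ fuel
          (count-mono-< (λ x → _~?_ C x ε) (λ x → _~?_ (adjoin C a) x ε) (adjoin-⊇ C a) a a≁ε (adjoin-∋ C a))))

      -- `U` still covers in every further quotient, as the kernels only grow. No cops are added on
      -- the way, since the quotient game and the guarding are played one after the other by the
      -- same cops.
      climbing : ∀ C → Covers C M U → Win C M (suc k)
      climbing C = climb n C (m≤m+n n _)

  -- Averaging over the guarding element

  x-[x-y]≡y : ∀ x y → x ∙ ((x ∙ (y ⁻¹)) ⁻¹) ≡ y
  x-[x-y]≡y x y = trans (cong (x ∙_) (⁻¹-anti-homo‿- x y)) (trans (sym (assoc x y (x ⁻¹))) (xyx⁻¹≈y x y))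

  translation reflection : Fin n → Permutation′ n
  translation u = permutation (_∙ u) (_∙ (u ⁻¹)) (//-rightDividesˡ u) (//-rightDividesʳ u)
  reflection u = permutation (λ a → u ∙ (a ⁻¹)) (λ a → u ∙ (a ⁻¹)) (x-[x-y]≡y u) (x-[x-y]≡y u)

  module Averaging (C : Congruence) {U : List (Fin n)} {f : ℕ}
                   (distinct : AllPairs (λ u v → ¬ Congruence._~_ C u v) U) (U⊆T : All T U)
                   (f<U : f < length U) (n≤fT : n ≤ f * count T?) where
    open Congruence C

    private
      h = count (_~? ε)
      #T̄ = count T̄?

      Active? : ∀ a u → Dec (¬ (a ~ ε) × Guarded C a u)
      Active? a u = ¬? (a ~? ε) ×-dec T̄? (u ∙ (a ⁻¹))

    -- Translation by `u` injects the trivial class into the class of `u`.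
    class-size : ∀ u → h ≤ count (_~? u)
    class-size u = ≤-trans
      (count-mono-≤ (_~? ε) (λ x → (x ∙ u) ~? u) (λ x~ε → ~-trans (∙-congʳ~ u x~ε) (~-reflexive (identityˡ u))))
      (≤-reflexive (sym (sum-permute (𝟙 ∘ (_~? u)) (translation u))))

    unique-representative : ∀ x {V} → AllPairs (λ u v → ¬ u ~ v) V → All T V →
                            length (filter (x ~?_) V) ≤ 𝟙 (T̄? x)
    unique-representative x [] [] = z≤n
    unique-representative x {u ∷ V} (u≁V ∷ V≁) (Tu ∷ TV) with x ~? u
    ... | no _ = unique-representative x V≁ TV
    ... | yes x~u = begin
      suc (length (filter (x ~?_) V)) ≡⟨ cong (suc ∘ length) (filter-none (x ~?_) (All.map (λ u≁v x~v → u≁v (~-trans (~-sym x~u) x~v)) u≁V)) ⟩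
      1                               ≡⟨ 𝟙-yes (T̄? x) (u , Tu , x~u) ⟨
      𝟙 (T̄? x)                        ∎
      where open ≤-Reasoning

    -- The classes of the entries of `U` are disjoint, lie in `T̄` and have at least `h` elements
    -- each.
    U*h≤#T̄ : length U * h ≤ #T̄
    U*h≤#T̄ = ≤-trans (double-counting (λ x u → x ~? u) (All.universal class-size U))
                    (sum-mono-≤ (λ x → unique-representative x distinct U⊆T))

    -- The reflection a ↦ u - a matches the elements guarding `u` with `T̄`; at most `h` of them are
    -- congruent to ε.
    active-count : ∀ u → #T̄ ∸ h ≤ count (λ a → Active? a u)
    active-count u = m≤n+o⇒m∸n≤o #T̄ h (begin
      #T̄                                 ≡⟨ sum-permute (𝟙 ∘ T̄?) (reflection u) ⟩
      count (λ a → T̄? (u ∙ (a ⁻¹)))      ≤⟨ count-∪ (λ a → T̄? (u ∙ (a ⁻¹))) (_~? ε) (λ a → Active? a u) (λ a g a≁ε → a≁ε , g) ⟩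
      count (λ a → Active? a u) + h      ≡⟨ +-comm _ h ⟩
      h + count (λ a → Active? a u)      ∎)
      where open ≤-Reasoning

    -- More than `f` disjoint classes in `T̄` give (1 + f) h ≤ #T̄, so f #T̄ = (1 + f) #T̄ - #T̄ is
    -- at most (1 + f)(#T̄ - h).
    n≤[#T̄∸h][1+f] : n ≤ (#T̄ ∸ h) * suc f
    n≤[#T̄∸h][1+f] = begin
      n                          ≤⟨ n≤fT ⟩
      f * count T?               ≤⟨ *-monoʳ-≤ f (count-mono-≤ T? T̄? (λ {t} Tt → t , Tt , ~-refl)) ⟩
      f * #T̄                     ≡⟨ m+n∸m≡n #T̄ (f * #T̄) ⟨
      suc f * #T̄ ∸ #T̄            ≤⟨ ∸-monoʳ-≤ (suc f * #T̄) (≤-trans (*-monoˡ-≤ h f<U) U*h≤#T̄) ⟩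
      suc f * #T̄ ∸ suc f * h     ≡⟨ *-distribˡ-∸ (suc f) #T̄ h ⟨
      suc f * (#T̄ ∸ h)           ≡⟨ *-comm (suc f) (#T̄ ∸ h) ⟩
      (#T̄ ∸ h) * suc f           ∎
      where open ≤-Reasoning

    private
      ψ : Fin n → ℕ
      ψ a = length (filter (Active? a) U)

    -- Double counting of the active pairs bounds the sum of `ψ` from below. The sum over `a` is
    -- strictly smaller than its bound because the group is inhabited by ε.
    average : ¬ (∀ a → ψ a * suc f < length U)
    average small = <-irrefl refl (begin-strict
      length U * n                         ≤⟨ *-monoʳ-≤ (length U) n≤[#T̄∸h][1+f] ⟩
      length U * ((#T̄ ∸ h) * suc f)        ≡⟨ *-assoc (length U) (#T̄ ∸ h) (suc f) ⟨
      length U * (#T̄ ∸ h) * suc f          ≤⟨ *-monoˡ-≤ (suc f) (double-counting Active? (All.universal active-count U)) ⟩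
      sum ψ * suc f                        ≡⟨ *-distribʳ-sum (suc f) ψ ⟩
      sum (λ a → ψ a * suc f)              <⟨ sum-mono-< (<⇒≤ ∘ small) ε (small ε) ⟩
      sum {n} (λ _ → length U)             ≡⟨ sum-const n (length U) ⟩
      n * length U                         ≡⟨ *-comm n (length U) ⟩
      length U * n                         ∎)
      where open ≤-Reasoning

    popular : ∃[ a ] ¬ (a ~ ε) × length U ≤ length (filter (λ u → T̄? (u ∙ (a ⁻¹))) U) * suc f
    popular with any? (λ a → length U ≤? ψ a * suc f)
    ... | no ¬∃ = contradiction (λ a → ≰⇒> (λ le → ¬∃ (a , le))) average
    ... | yes (a , U≤) = a , a≁ε , ≤-trans U≤ (*-monoˡ-≤ (suc f) (filter-⊆ U))
      where
      -- For a ~ ε no pair is active, so `ψ a` would vanish although `U` is nonempty.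
      a≁ε : ¬ (a ~ ε)
      a≁ε a~ε = <⇒≱ f<U (≤-trans U≤ (≤-trans
        (≤-reflexive (cong (λ xs → length xs * suc f) (filter-none (Active? a) (All.universal (λ _ (a≁ε , _) → a≁ε a~ε) U)))) z≤n))
      filter-⊆ : ∀ V → length (filter (Active? a) V) ≤ length (filter (λ u → T̄? (u ∙ (a ⁻¹))) V)
      filter-⊆ []      = z≤n
      filter-⊆ (v ∷ V) = subst₂ _≤_ (sym (length-filter-∷ (Active? a) v V)) (sym (length-filter-∷ (λ u → T̄? (u ∙ (a ⁻¹))) v V))
        (+-mono-≤ (𝟙-mono (Active? a v) (T̄? (v ∙ (a ⁻¹))) proj₂) (filter-⊆ V))

  module _ (C : Congruence) {M : Pred (Fin n) 0ℓ} (M⊆T : ∀ {s} → M s → T s) (a : Fin n) where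
    open Congruence C
    open Guarding C M M⊆T a using (Unguarded)

    guarded-resp : ∀ {s u} → s ~ u → Guarded C a u → Guarded C a s
    guarded-resp s~u (t , Tt , u-a~t) = t , Tt , ~-trans (∙-congʳ~ (a ⁻¹) s~u) u-a~t

    unguarded-covers : ∀ {U} → Covers C M U → Covers C Unguarded (filter (λ u → ¬? (T̄? (u ∙ (a ⁻¹)))) U)
    unguarded-covers cov (Ms , ¬Gs) with Any.filter⁺ (λ u → ¬? (T̄? (u ∙ (a ⁻¹)))) (cov Ms)
    ... | inj₁ any = any
    ... | inj₂ ¬¬G = contradiction (λ Gu → ¬Gs (guarded-resp (Any.lookup-result (cov Ms)) Gu)) ¬¬G

  -- Numbers of cops that suffice

  module _ (generates : ∀ C → (∀ {t} → T t → Congruence._~_ C t ε) → Congruence.IsTrivial C) where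

    -- One cop per listed move: each guard is chosen so that it guards the head of the list.
    win-few : ∀ k {C M U} → (∀ {s} → M s → T s) → Covers C M U → length U ≤ k → Win C M k
    win-few k       {U = []}    M⊆T cov _          = win-∅ k cov
    win-few (suc k) {C} {M} {U = u ∷ U} M⊆T cov (s≤s U≤k) = Climbing.climbing M⊆T step C cov
      where
      step : ∀ C → Covers C M (u ∷ U) →
             Win C M (suc k) ⊎ (∃[ a ] ¬ Congruence._~_ C a ε × Win C (Guarding.Unguarded C M M⊆T a) k)
      step C cov with any? (λ t → T? t ×-dec ¬? (Congruence._~?_ C (u ∙ (t ⁻¹)) ε))
      ... | yes (t , Tt , a≁ε) = inj₂ (a , a≁ε , win-few k (M⊆T ∘ proj₁) cov′ U≤k)
        where
        open Congruence C
        -- With this choice u - a = t lies in `T`, so `u` is guarded.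
        a = u ∙ (t ⁻¹)
        cov′ : Covers C (Guarding.Unguarded C M M⊆T a) U
        cov′ (Ms , ¬Gs) with cov Ms
        ... | here s~u = contradiction (guarded-resp C M⊆T a s~u (t , Tt , ~-reflexive (x-[x-y]≡y u t))) ¬Gs
        ... | there s∈U = s∈U
      -- All of `T` is congruent to `u`, hence to its member ε; as `T` generates, the quotient is
      -- trivial and any cop has already succeeded.
      ... | no ¬∃ = inj₁ (λ d → caught zero (generates C t~ε (d zero)))
        where
        open Congruence C
        u~ : ∀ {t} → T t → u ~ t
        u~ {t} Tt with (u ∙ (t ⁻¹)) ~? ε
        ... | yes eq = subst₂ _~_ (//-rightDividesˡ t u) (identityˡ t) (∙-congʳ~ t eq)
        ... | no neq = contradiction (t , Tt , neq) ¬∃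
        t~ε : ∀ {t} → T t → t ~ ε
        t~ε Tt = ~-trans (~-sym (u~ Tt)) (u~ T-ε)

    -- The hypothesis survives each averaged guard with j lowered by one, and at j = 0 it says that
    -- `U` has at most `f` entries.
    win-many : ∀ f j {C M U} → n ≤ f * count T? → (∀ {s} → M s → T s) → All T U → Covers C M U →
               length U * f ^ j < suc f ^ suc j → Win C M (j + f)
    win-many f zero {U = U} n≤fT M⊆T U⊆T cov small = win-few f M⊆T cov
      (s≤s⁻¹ (subst₂ _<_ (*-identityʳ (length U)) (*-identityʳ (suc f)) small))
    win-many f (suc j) {C} {M} {U} n≤fT M⊆T U⊆T cov small = Climbing.climbing M⊆T step C cov
      where
      step : ∀ C → Covers C M U →
             Win C M (suc j + f) ⊎ (∃[ a ] ¬ Congruence._~_ C a ε × Win C (Guarding.Unguarded C M M⊆T a) (j + f))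
      step C cov = decide (length V ≤? suc j + f)
        where
        open Congruence C
        -- Moves may merge in the quotient, while averaging requires pairwise incongruent ones.
        V = deduplicate _~?_ U
        covV : Covers C M V
        covV Ms = Any.deduplicate⁺ _~?_ (λ u~v s~v → ~-trans s~v (~-sym u~v)) (cov Ms)
        decide : Dec (length V ≤ suc j + f) →
                 Win C M (suc j + f) ⊎ (∃[ a ] ¬ (a ~ ε) × Win C (Guarding.Unguarded C M M⊆T a) (j + f))
        decide (yes V≤) = inj₁ (win-few (suc j + f) M⊆T covV V≤)
        decide (no V≰)
          with a , a≁ε , V≤ ← Averaging.popular C {V} {f} (deduplicate-! ~-decSetoid U) (All.deduplicate⁺ _~?_ U⊆T)
                                (≤-<-trans (m≤n+m f (suc j)) (≰⇒> V≰)) n≤fT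
          = inj₂ (a , a≁ε , win-many f j n≤fT (M⊆T ∘ proj₁) (All.filter⁺ G? (All.deduplicate⁺ _~?_ U⊆T))
                              (unguarded-covers C M⊆T a covV) small′)
          where
          G? = λ u → ¬? (T̄? (u ∙ (a ⁻¹)))
          v = length V
          w = length (filter G? V)
          g = length (filter (λ u → T̄? (u ∙ (a ⁻¹))) V)
          -- Of `v` moves, the `g` guarded ones satisfy v ≤ g (1 + f); subtract this from (g + w)(1
          -- + f) = v (1 + f).
          w[1+f]≤vf : w * suc f ≤ v * f
          w[1+f]≤vf = +-cancelˡ-≤ v _ _ (begin
            v + w * suc f         ≤⟨ +-monoˡ-≤ (w * suc f) V≤ ⟩
            g * suc f + w * suc f ≡⟨ *-distribʳ-+ (suc f) g w ⟨
            (g + w) * suc f       ≡⟨ cong (_* suc f) (length-filter-split (λ u → T̄? (u ∙ (a ⁻¹))) V) ⟩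
            v * suc f             ≡⟨ *-suc v f ⟩
            v + v * f             ∎)
            where open ≤-Reasoning
          swap : ∀ x y z → x * y * z ≡ x * z * y
          swap x y z = trans (*-assoc x y z) (trans (cong (x *_) (*-comm y z)) (sym (*-assoc x z y)))
          small′ : w * f ^ j < suc f ^ suc j
          small′ = *-cancelʳ-< (suc f) _ _ (begin-strict
            w * f ^ j * suc f         ≡⟨ swap w (f ^ j) (suc f) ⟩
            w * suc f * f ^ j         ≤⟨ *-monoˡ-≤ (f ^ j) w[1+f]≤vf ⟩
            v * f * f ^ j             ≡⟨ *-assoc v f (f ^ j) ⟩
            v * f ^ suc j             ≤⟨ *-monoˡ-≤ (f ^ suc j) (length-deduplicate _~?_ U) ⟩
            length U * f ^ suc j      <⟨ small ⟩
            suc f * suc f ^ suc j     ≡⟨ *-comm (suc f) (suc f ^ suc j) ⟩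
            suc f ^ suc j * suc f     ∎)
            where open ≤-Reasoning

    moves : List (Fin n)
    moves = filter T? (allFin n)

    length-moves : length moves ≡ count T?
    length-moves = length-filter-tabulate T? (λ i → i)

    covers : Covers discrete T moves
    covers {s} Ts = ∈-filter⁺ T? (∈-allFin s) Ts

    count≤n : count T? ≤ n
    count≤n = subst₂ _≤_ length-moves (length-tabulate (λ i → i)) (length-filter T? (allFin n))

    win-all : ∀ k → 7 * n < 4 * (k * k) → Win discrete T (suc k)
    win-all k 7n<4k² with count T? ≤? suc k
    ... | yes t≤k = win-few (suc k) (λ Tt → Tt) covers (≤-trans (≤-reflexive length-moves) t≤k)
    ... | no t≰k
      with f , j , j+f≡k , n≤ft , small ← parameters n (count T?) k count≤n (≰⇒> t≰k) 7n<4k²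
      = subst (Win discrete T) j+f≡k (win-many f j n≤ft (λ Tt → Tt) (All.all-filter T? (allFin n)) covers
          (subst (λ t → t * f ^ j < suc f ^ suc j) (sym length-moves) small))

-- From differences to positions

module Transfer
  {a ℓ p} (G : AbelianGroup a ℓ) {n} (G≅n : HasSize (AbelianGroup.setoid G) n)
  {S : Pred (AbelianGroup.Carrier G) p} (S-resp : S Respects (AbelianGroup._≈_ G))
  (generates : Generates G S) (S? : Decidable S)
  where

  open AbelianGroup G renaming (refl to ≈-refl; sym to ≈-sym; trans to ≈-trans)
  open AbelianGroupProperties G using (xyx⁻¹≈y; //-rightDividesˡ; x≈z//y)
  open Inverse G≅n using (to; from; to-cong; from-cong; strictlyInverseˡ; strictlyInverseʳ)
  open CommutativeMonoidSolver commutativeMonoid using (solve; _⊕_; _⊜_)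
  open Game (Cay G S S-resp) hiding (CopsWin; IsCopNumber)
  open import Relation.Binary.Reasoning.Setoid setoid

  private
    rawGroup′ : RawGroup 0ℓ 0ℓ
    rawGroup′ = record
      { Carrier = Fin n
      ; _≈_     = _≡_
      ; _∙_     = λ x y → to (from x ∙ from y)
      ; ε       = to ε
      ; _⁻¹     = λ x → to (from x ⁻¹)
      }

    from-isMonomorphism : IsGroupMonomorphism rawGroup′ rawGroup from
    from-isMonomorphism = record
      { isGroupHomomorphism = record
        { isMonoidHomomorphism = record
          { isMagmaHomomorphism = record
            { isRelHomomorphism = record { cong = from-cong }
            ; homo = λ x y → strictlyInverseʳ (from x ∙ from y)
            }
          ; ε-homo = strictlyInverseʳ ε
          }
        ; ⁻¹-homo = λ x → strictlyInverseʳ (from x ⁻¹)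
        }
      ; injective = λ {x} {y} eq → ≡.trans (≡.sym (strictlyInverseˡ x)) (≡.trans (to-cong eq) (strictlyInverseˡ y))
      }

    isAbelianGroup′ : IsAbelianGroup _≡_ (λ x y → to (from x ∙ from y)) (to ε) (λ x → to (from x ⁻¹))
    isAbelianGroup′ = GroupMonomorphism.isAbelianGroup from-isMonomorphism isAbelianGroup

    -- The set S ∪ {0}, with `True` bringing membership in `S` down to level 0 from any universe.
    T′ : Pred (Fin n) 0ℓ
    T′ i = i ≡ to ε ⊎ True (S? (from i))

    T′? : Decidable T′
    T′? i = (i ≟ to ε) ⊎-dec T? (isYes (S? (from i)))

  open Pursuit isAbelianGroup′ {T′} T′? (inj₁ ≡.refl)

  T′-to : ∀ {x} → x ≈ ε ⊎ S x → T′ (to x)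
  T′-to (inj₁ x≈ε)    = inj₁ (to-cong x≈ε)
  T′-to {x} (inj₂ Sx) = inj₂ (fromWitness {a? = S? (from (to x))} (S-resp (≈-sym (strictlyInverseʳ x)) Sx))

  -- The elements of trivial class form a subgroup containing `S`; the proof is an induction on
  -- `Span`.
  T′-generates : ∀ C → (∀ {t} → T′ t → Congruence._~_ C t (to ε)) → Congruence.IsTrivial C
  T′-generates C T~ε i = ~-trans (~-reflexive (≡.sym (strictlyInverseˡ i))) (span (generates (from i)))
    where
    open Congruence C
    module G′ = IsAbelianGroup isAbelianGroup′
    span : ∀ {x} → Span G S x → to x ~ to ε
    span (gen Sx)      = T~ε (T′-to (inj₂ Sx))
    span unit          = ~-refl
    span (mul {x} {y} X Y) = ~-trans
      (~-reflexive (to-cong (∙-cong (≈-sym (strictlyInverseʳ x)) (≈-sym (strictlyInverseʳ y)))))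
      (~-trans (∙-congʳ~ (to y) (span X)) (~-trans (~-reflexive (G′.identityˡ (to y))) (span Y)))
    span (inv {x} X)   = ~-trans
      (~-reflexive (≡.trans (to-cong (⁻¹-cong (≈-sym (strictlyInverseʳ x)))) (≡.sym (G′.identityˡ _))))
      (~-trans (~-sym (∙-congʳ~ (to (from (to x) ⁻¹)) (span X))) (~-reflexive (G′.inverseʳ (to x))))
    span (resp x≈y X)  = ~-trans (~-reflexive (to-cong (≈-sym x≈y))) (span X)

  Positions : ℕ → Set a
  Positions k = Fin k → Carrier

  -- `idle` is the default once a cop has caught the robber or the robber has moved illegally; a
  -- strategy must answer every history.
  data Plan {k} (r : Carrier) (c : Positions k) : Set (a Level.⊔ ℓ) where
    idle : Plan r c
    live : ∀ {d : Fin k → Fin n} → Forces discrete T′ d → (∀ i → c i ∙ from (d i) ≈ r) → Plan r c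

  module _ {k : ℕ} where

    Answer : Carrier → Positions k → Set _
    Answer r c = ∃[ c′ ] (∀ i → Step (c i) (c′ i)) × Plan r c′

    rest : ∀ {r c} → Answer r c
    rest {c = c} = c , (λ _ → inj₁ ≈-refl) , idle

    answer-move : ∀ {r r′} {c : Positions k} {d d′ : Fin k → Fin n} → (∀ i → c i ∙ from (d i) ≈ r) →
                  (∀ i → ∃[ t ] T′ t × to (from (d′ i) ∙ from t) ≡ to (from (d i) ∙ from (to (r′ - r)))) →
                  Forces discrete T′ d′ → Answer r′ c
    answer-move {r} {r′} {c} {d} {d′} c∙d≈r moves F = c′ , step , live F (λ i → //-rightDividesˡ (from (d′ i)) r′)
      where
      c′ : Positions k
      -- Forced by the invariant that position plus difference is the robber's vertex.
      c′ i = r′ - from (d′ i)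
      shuffle : ∀ x y z → (x ∙ y) ∙ z ≈ x ∙ (z ∙ y)
      shuffle = solve 3 (λ x y z → (x ⊕ y) ⊕ z ⊜ x ⊕ (z ⊕ y)) ≈-refl
      c∙t≈c′ : ∀ i {t} → to (from (d′ i) ∙ from t) ≡ to (from (d i) ∙ from (to (r′ - r))) → c i ∙ from t ≈ c′ i
      c∙t≈c′ i {t} eq = x≈z//y _ _ _ (begin
        (c i ∙ from t) ∙ from (d′ i)                      ≈⟨ shuffle (c i) (from t) (from (d′ i)) ⟩
        c i ∙ (from (d′ i) ∙ from t)                      ≈⟨ ∙-congˡ (strictlyInverseʳ _) ⟨
        c i ∙ from (to (from (d′ i) ∙ from t))            ≈⟨ ∙-congˡ (from-cong eq) ⟩
        c i ∙ from (to (from (d i) ∙ from (to (r′ - r)))) ≈⟨ ∙-congˡ (strictlyInverseʳ _) ⟩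
        c i ∙ (from (d i) ∙ from (to (r′ - r)))           ≈⟨ assoc _ _ _ ⟨
        (c i ∙ from (d i)) ∙ from (to (r′ - r))           ≈⟨ ∙-cong (c∙d≈r i) (strictlyInverseʳ _) ⟩
        r ∙ (r′ - r)                                      ≈⟨ assoc _ _ _ ⟨
        (r ∙ r′) - r                                      ≈⟨ xyx⁻¹≈y r r′ ⟩
        r′                                                ∎)
      step : ∀ i → Step (c i) (c′ i)
      step i with moves i
      ... | t , inj₁ t≡ε , eq = inj₁ (begin
        c i           ≈⟨ identityʳ (c i) ⟨
        c i ∙ ε       ≈⟨ ∙-congˡ (≈-trans (from-cong t≡ε) (strictlyInverseʳ ε)) ⟨
        c i ∙ from t  ≈⟨ c∙t≈c′ i eq ⟩
        c′ i          ∎)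
      ... | t , inj₂ St , eq = inj₂ (S-resp (begin
        from t                 ≈⟨ xyx⁻¹≈y (c i) (from t) ⟨
        (c i ∙ from t) - c i   ≈⟨ ∙-congʳ (c∙t≈c′ i eq) ⟩
        c′ i - c i             ∎) (toWitness {a? = S? (from t)} St))

    -- The decision is an explicit argument so that `captures` can split on it inside an equation
    -- between states.
    answer-dec : ∀ {r r′} {c : Positions k} {d : Fin k → Fin n} (d′ : ∀ s → T′ s → Fin k → Fin n) →
                 (∀ i → c i ∙ from (d i) ≈ r) →
                 (∀ s (Ts : T′ s) i → ∃[ t ] T′ t × to (from (d′ s Ts i) ∙ from t) ≡ to (from (d i) ∙ from s)) →
                 (∀ s (Ts : T′ s) → Forces discrete T′ (d′ s Ts)) → Dec (T′ (to (r′ - r))) → Answer r′ c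
    answer-dec {d = d} d′ c∙d≈r moves next (yes Ts) = answer-move {d = d} c∙d≈r (moves _ Ts) (next _ Ts)
    answer-dec d′ c∙d≈r moves next (no _) = rest

    answer : ∀ {r} r′ {c : Positions k} → Plan r c → Answer r′ c
    answer r′ idle                  = rest
    answer r′ (live (caught _ _) _) = rest
    answer {r} r′ (live {d} (round d′ moves next) c∙d≈r) = answer-dec {d = d} d′ c∙d≈r moves next (T′? (to (r′ - r)))

    module _ (win : Win discrete T′ k) where

      State : Carrier → Set _
      State r = ∃[ c ] Plan {k} r c

      advance : ∀ {r} r′ → State r → State r′
      advance r′ (c , plan) = let c′ , _ , plan′ = answer r′ plan in c′ , plan′

      state : ∀ r → List Carrier → State r
      -- All cops start at ε and stand still on their first turn, so every initial difference is the
      -- robber's starting vertex.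
      state r []       = (λ _ → ε) , live (win (λ _ → to r)) (λ _ → ≈-trans (identityˡ _) (strictlyInverseʳ r))
      state r (r₀ ∷ h) = advance r (state r₀ h)

      strategy : Strategy k
      strategy = record { position = position ; legal = legal }
        where
        position : List Carrier → Fin k → Carrier
        position []      = λ _ → ε
        position (r ∷ h) = proj₁ (state r h)
        legal : ∀ h r i → Step (position h i) (position (r ∷ h) i)
        legal []       r i = inj₁ ≈-refl
        legal (r₀ ∷ h) r i = proj₁ (proj₂ (answer r (proj₂ (state r₀ h)))) i

      captures : ∀ r → RobberPlay r → Captures strategy r
      captures r play = go 0 (win _) _ ≡.refl
        where
        -- Recursion on the strategy tree; the equation ties the current node to the actual state
        -- after `t` robber moves.
        go : ∀ t {c} {d : Fin k → Fin n} (F : Forces discrete T′ d) (c∙d≈r : ∀ i → c i ∙ from (d i) ≈ r t) →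
             state (r t) (before r t) ≡ (c , live F c∙d≈r) → Captures strategy r
        go t {c} {d} (caught i di≡ε) c∙d≈r eq = t , i , inj₂ (begin
          proj₁ (state (r t) (before r t)) i ≡⟨ ≡.cong (λ s → proj₁ s i) eq ⟩
          c i                                ≈⟨ identityʳ (c i) ⟨
          c i ∙ ε                            ≈⟨ ∙-congˡ (≈-trans (from-cong di≡ε) (strictlyInverseʳ ε)) ⟨
          c i ∙ from (d i)                   ≈⟨ c∙d≈r i ⟩
          r t                                ∎)
        go t {c} {d} (round d′ moves next) c∙d≈r eq = go′ (T′? s) (≡.cong (advance (r (suc t))) eq)
          where
          s = to (r (suc t) - r t)
          Ts : T′ s
          Ts with play t
          ... | inj₁ u≈v  = T′-to (inj₁ (≈-trans (∙-congʳ (≈-sym u≈v)) (inverseʳ _)))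
          ... | inj₂ Sv-u = T′-to (inj₂ Sv-u)
          go′ : (s∈T? : Dec (T′ s)) →
                let c′ , _ , plan′ = answer-dec {d = d} d′ c∙d≈r moves next s∈T? in
                state (r (suc t)) (before r (suc t)) ≡ (c′ , plan′) → Captures strategy r
          go′ (yes Ts) eq = go (suc t) (next s Ts) _ eq
          go′ (no ¬Ts) _  = contradiction Ts ¬Ts

  copsWin : ∀ k → 7 * n < 4 * (k * k) → CopsWin (Cay G S S-resp) (suc k)
  copsWin k 7n<4k² = strategy win , captures win
    where
    win : Win discrete T′ (suc k)
    win = win-all T′-generates k 7n<4k²

-- Decidability up to double negation, and the final bound

¬¬-decidable : ∀ {n} (P : Pred (Fin n) p) → ¬ ¬ Decidable P
¬¬-decidable {n = zero}  P k = k λ ()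
¬¬-decidable {n = suc n} P k = ¬¬-excluded-middle λ P0? → ¬¬-decidable (P ∘ suc) λ Psuc? →
  k λ { zero → P0? ; (suc i) → Psuc? i }

theorem4p8 : ∀ {a ℓ p} (G : AbelianGroup a ℓ) → let open AbelianGroup G in
    (n : ℕ) → HasSize setoid n →
    (S : Pred Carrier p) (S-resp : S Respects _≈_) →
    Generates G S → ¬ S ε →
    (c : ℕ) → IsCopNumber (Cay G S S-resp) c →
    fromℕ c ≤ᵣ √ (fromℕ 2 /ᵣ ((√ (fromℕ 2) -ᵣ fromℕ 1) *ᵣ e)) *ᵣ √ (fromℕ n) +ᵣ fromℕ 2
theorem4p8 G n G≅n S S-resp generates _ c (_ , minimal) bound<c =
  -- The goal unfolds to a negation, so `S` may be taken to be decidable.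
  ¬¬-decidable (S ∘ from) λ S∘from? →
    let S? = λ x → map′ (S-resp (strictlyInverseʳ x)) (S-resp (AbelianGroup.sym G (strictlyInverseʳ x))) (S∘from? (to x))
        k , c≡2+k , 7n<4k² = bound-below {n} {c} bound<c
    -- A cop number c = 2 + k contradicts the win of `suc k` cops.
    in 1+n≰n (subst (_≤ suc k) c≡2+k (minimal (suc k) (Transfer.copsWin G G≅n S-resp generates S? k 7n<4k²)))
  where open Inverse G≅n using (to; from; strictlyInverseʳ)
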